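{- For all integers $L\geq 1$ and $n\geq 0$, $$ \sum_{m\geq 0}\binom{m}{2}\,a_2\!\left(\left\lceil\frac{L}{2}\right\rceil,m,n\right)\ \geq\ \sum_{m\geq 0}\binom{m}{2}\,b_2(L,m,n). $$
   Context: The hook length of a cell in the Young diagram of a partition is one plus the number of cells to its right in the same row plus the number of cells below it in the same column. A hook of length two means a cell whose hook length equals $2$. For integers $L\ge 1$ and $m,n\ge 0$: $a_2(L,m,n)$ is the number of partitions of $n$ into odd parts (repetitions allowed), each at most $2L-1$, having exactly $m$ hooks of length two; $b_2(L,m,n)$ is the number of partitions of $n$ into distinct parts, each at most $L$, having exactly $m$ hooks of length two. -}

module Defs where

open import Data.Empty using (⊥)
open import Data.List.Base using (List; []; _∷_; _++_; map; filter; length; upTo)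
open import Data.List.Membership.Propositional using (_∈_)
open import Data.List.Membership.Propositional.Properties
  using (∈-map⁺; ∈-map⁻; ∈-++⁺ˡ; ∈-++⁺ʳ; ∈-filter⁺; ∈-filter⁻)
open import Data.List.Properties using (length-++; length-map; length-upTo; length-filter; filter-none)
open import Data.List.Relation.Unary.All as All using (All; []; _∷_)
import Data.List.Relation.Unary.All.Properties as All
open import Data.List.Relation.Unary.Any using (here)
open import Data.List.Relation.Unary.Linked using (Linked; linked?)
open import Data.List.Relation.Unary.Unique.DecPropositional using (unique?)
open import Data.List.Relation.Unary.Unique.Propositional using (Unique; []; _∷_)
open import Data.List.Relation.Unary.Unique.Propositional.Properties using (map⁺; ++⁺; filter⁺)
open import Data.Nat.Base
open import Data.Nat.DivMod using (_%_)
open import Data.Nat.ListAction using (sum)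
open import Data.Nat.Properties
open import Data.Product.Base using (_×_; _,_; proj₁)
open import Relation.Binary.PropositionalEquality
open import Relation.Nullary.Decidable using (_×-dec_)
open import Relation.Unary using (Decidable)

record IsPartitionOf (n : ℕ) (ps : List ℕ) : Set where
  field
    weaklyDecreasing : Linked _≥_ ps
    positive         : All (0 <_) ps
    total            : sum ps ≡ n

-- For the cell in row p and column j (counted from 0), with ps the rows below:
-- p ∸ suc j cells lie to its right, and one cell lies below it in each row q
-- of ps with j < q.
hookLength : (p : ℕ) (ps : List ℕ) (j : ℕ) → ℕ
hookLength p ps j = 1 + (p ∸ suc j) + length (filter (j <?_) ps)

-- The hook lengths of all cells of the diagram, with multiplicity.
hookLengths : List ℕ → List ℕ
hookLengths []       = []
hookLengths (p ∷ ps) = map (hookLength p ps) (upTo p) ++ hookLengths ps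

hooks₂ : List ℕ → ℕ
hooks₂ ps = length (filter (_≟ 2) (hookLengths ps))

incHead : List ℕ → List ℕ
incHead []       = []
incHead (p ∷ ps) = suc p ∷ ps

-- Ordered sums of positive parts: a composition of 2 + n either begins with 1
-- or comes from a composition of 1 + n by increasing the first part.
compositions : ℕ → List (List ℕ)
compositions 0             = [] ∷ []
compositions 1             = (1 ∷ []) ∷ []
compositions (suc (suc n)) =
  map (1 ∷_) (compositions (suc n)) ++ map incHead (compositions (suc n))

-- By partitions-sound, partitions-complete and partitions-unique below, this
-- lists every partition of n exactly once.
partitions : ℕ → List (List ℕ)
partitions n = filter (linked? _≥?_) (compositions n)

OddPartsAtMost : ℕ → List ℕ → Set
OddPartsAtMost k = All (λ p → p % 2 ≡ 1 × p ≤ k)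

oddPartsAtMost? : ∀ k → Decidable (OddPartsAtMost k)
oddPartsAtMost? k = All.all? (λ p → (p % 2 ≟ 1) ×-dec (p ≤? k))

DistinctPartsAtMost : ℕ → List ℕ → Set
DistinctPartsAtMost k ps = Unique ps × All (_≤ k) ps

distinctPartsAtMost? : ∀ k → Decidable (DistinctPartsAtMost k)
distinctPartsAtMost? k ps = unique? _≟_ ps ×-dec All.all? (_≤? k) ps

hooksOddAtMost? : ∀ k m → Decidable (λ ps → OddPartsAtMost k ps × hooks₂ ps ≡ m)
hooksOddAtMost? k m ps = oddPartsAtMost? k ps ×-dec (hooks₂ ps ≟ m)

hooksDistinctAtMost? : ∀ k m → Decidable (λ ps → DistinctPartsAtMost k ps × hooks₂ ps ≡ m)
hooksDistinctAtMost? k m ps = distinctPartsAtMost? k ps ×-dec (hooks₂ ps ≟ m)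

a₂ : (L m n : ℕ) → ℕ
a₂ L m n = length (filter (hooksOddAtMost? (2 * L ∸ 1) m) (partitions n))

b₂ : (L m n : ℕ) → ℕ
b₂ L m n = length (filter (hooksDistinctAtMost? L m) (partitions n))

∑[m≤_] : ℕ → (ℕ → ℕ) → ℕ
∑[m≤ N ] f = sum (map f (upTo (suc N)))

Composes : ℕ → List ℕ → Set
Composes n ps = All (0 <_) ps × sum ps ≡ n

1∷-composes : ∀ {n ps} → Composes n ps → Composes (suc n) (1 ∷ ps)
1∷-composes (pos , eq) = (z<s ∷ pos) , cong suc eq

incHead-composes : ∀ {n ps} → Composes (suc n) ps → Composes (suc (suc n)) (incHead ps)
incHead-composes {ps = []}    (_ , ())
incHead-composes {ps = _ ∷ _} (_ ∷ pos , eq) = (z<s ∷ pos) , cong suc eq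

compositions-all : ∀ n → All (Composes n) (compositions n)
compositions-all 0             = ([] , refl) ∷ []
compositions-all 1             = (z<s ∷ [] , refl) ∷ []
compositions-all (suc (suc n)) = All.++⁺
  (All.map⁺ (All.map 1∷-composes (compositions-all (suc n))))
  (All.map⁺ (All.map incHead-composes (compositions-all (suc n))))

compositions-sound : ∀ n {ps} → ps ∈ compositions n → Composes n ps
compositions-sound n = All.lookup (compositions-all n)

compositions-complete : ∀ n {ps} → All (0 <_) ps → sum ps ≡ n → ps ∈ compositions n
compositions-complete 0 {[]}               _         _  = here refl
compositions-complete 0 {zero ∷ _}         (() ∷ _)  _
compositions-complete 0 {suc _ ∷ _}        _         ()
compositions-complete (suc _) {[]}         _         ()
compositions-complete (suc _) {zero ∷ _}   (() ∷ _)  _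
compositions-complete 1 {1 ∷ []}           _         _  = here refl
compositions-complete 1 {1 ∷ zero ∷ _}     (_ ∷ () ∷ _) _
compositions-complete 1 {1 ∷ suc _ ∷ _}    _         ()
compositions-complete 1 {suc (suc _) ∷ _}  _         ()
compositions-complete (suc (suc n)) {1 ∷ ps} (_ ∷ pos) eq =
  ∈-++⁺ˡ (∈-map⁺ (1 ∷_) (compositions-complete (suc n) pos (suc-injective eq)))
compositions-complete (suc (suc n)) {suc (suc p) ∷ ps} (_ ∷ pos) eq =
  ∈-++⁺ʳ (map (1 ∷_) (compositions (suc n)))
    (∈-map⁺ incHead (compositions-complete (suc n) (z<s ∷ pos) (suc-injective eq)))

incHead-injective : ∀ {ps qs} → incHead ps ≡ incHead qs → ps ≡ qs
incHead-injective {[]}    {[]}    _    = refl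
incHead-injective {_ ∷ _} {_ ∷ _} refl = refl

compositions-unique : ∀ n → Unique (compositions n)
compositions-unique 0             = [] ∷ []
compositions-unique 1             = [] ∷ []
compositions-unique (suc (suc n)) =
  ++⁺ (map⁺ (λ { refl → refl }) (compositions-unique (suc n)))
      (map⁺ incHead-injective (compositions-unique (suc n)))
      disjoint
  where
  disjoint : ∀ {ps} → ps ∈ map (1 ∷_) (compositions (suc n)) ×
                      ps ∈ map incHead (compositions (suc n)) → ⊥
  disjoint (l , r) with ∈-map⁻ (1 ∷_) l | ∈-map⁻ incHead r
  ... | _ , _ , refl | zero ∷ _ , q∈ , refl with proj₁ (compositions-sound (suc n) q∈)
  ...   | () ∷ _

partitions-sound : ∀ {n ps} → ps ∈ partitions n → IsPartitionOf n ps
partitions-sound {n} ps∈ with ∈-filter⁻ (linked? _≥?_) ps∈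
... | c∈ , dec with compositions-sound n c∈
...   | pos , eq = record { weaklyDecreasing = dec ; positive = pos ; total = eq }

partitions-complete : ∀ {n ps} → IsPartitionOf n ps → ps ∈ partitions n
partitions-complete {n} p =
  ∈-filter⁺ (linked? _≥?_) (compositions-complete n positive total) weaklyDecreasing
  where open IsPartitionOf p

partitions-unique : ∀ n → Unique (partitions n)
partitions-unique n = filter⁺ (linked? _≥?_) (compositions-unique n)

-- A partition of n has n cells, so a₂ L m n and b₂ L m n vanish for m > n and
-- ∑[m≤ n ] agrees with the sum over all m ≥ 0.

length-hookLengths : ∀ ps → length (hookLengths ps) ≡ sum ps
length-hookLengths []       = refl
length-hookLengths (p ∷ ps) = trans
  (length-++ (map (hookLength p ps) (upTo p)))
  (cong₂ _+_ (trans (length-map (hookLength p ps) (upTo p)) (length-upTo p))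
             (length-hookLengths ps))

hooks₂≤sum : ∀ ps → hooks₂ ps ≤ sum ps
hooks₂≤sum ps = ≤-trans (length-filter (_≟ 2) (hookLengths ps))
                        (≤-reflexive (length-hookLengths ps))

hooks₂≤n : ∀ {n ps} → ps ∈ partitions n → hooks₂ ps ≤ n
hooks₂≤n {ps = ps} ps∈ =
  ≤-trans (hooks₂≤sum ps) (≤-reflexive (IsPartitionOf.total (partitions-sound ps∈)))

a₂-vanishes : ∀ L {m n} → n < m → a₂ L m n ≡ 0
a₂-vanishes L {m} n<m = cong length (filter-none (hooksOddAtMost? (2 * L ∸ 1) m)
  (All.tabulate λ ps∈ (_ , h≡m) → <⇒≱ n<m (subst (_≤ _) h≡m (hooks₂≤n ps∈))))

b₂-vanishes : ∀ L {m n} → n < m → b₂ L m n ≡ 0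
b₂-vanishes L {m} n<m = cong length (filter-none (hooksDistinctAtMost? L m)
  (All.tabulate λ ps∈ (_ , h≡m) → <⇒≱ n<m (subst (_≤ _) h≡m (hooks₂≤n ps∈))))

{-# OPTIONS --safe #-}
module Submission where

-- Write (n;2)_x for the Gaussian binomial coefficient with base x. Since C(m, 2)
-- counts pairs of hooks, the two sides are coefficients of the generating functions
-- of partitions with two marked hooks, and it suffices to treat L = 2K. Distinct
-- parts at most L give q⁶ (L-2;2)_q ∏_{3 ≤ k ≤ L-2} (1 + qᵏ). Odd parts below 2K give
-- at least P · h₂(q³, q⁵, …, q²ᴷ⁻¹) = P · q⁶ (K;2)_{q²}, where P generates the odd
-- partitions and h₂ is the complete homogeneous symmetric polynomial. As
-- (2j;2)_q ≤ (1 + q)(1 + q²) (j+1;2)_{q²} coefficientwise, the former is at most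
-- q⁶ (K;2)_{q²} ∏_{k ≤ 2K-2} (1 + qᵏ), and Glaisher's correspondence bounds the
-- product by P.

open import Defs
open import Algebra.Bundles using (CommutativeSemiring)
open import Algebra.Structures.Biased using (isCommutativeSemiringˡ)
open import Data.Empty using (⊥)
open import Data.List.Base using (List; []; _∷_; _++_; [_]; map; filter; length; upTo; replicate)
open import Data.List.Membership.Propositional using (_∈_; _∉_)
open import Data.List.Membership.Propositional.Properties
  using (∈-map⁺; ∈-map⁻; ∈-++⁺ˡ; ∈-++⁺ʳ; ∈-++⁻; ∈-∃++; ∈-filter⁺; ∈-filter⁻)
import Data.List.Properties as List
open import Data.List.Relation.Binary.Permutation.Propositional.Properties using (map⁺; shift)
open import Data.List.Relation.Unary.All as All using (All; []; _∷_)
import Data.List.Relation.Unary.All.Properties as All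
open import Data.List.Relation.Unary.AllPairs as AllPairs using (AllPairs; []; _∷_)
open import Data.List.Relation.Unary.Any using (here; there)
open import Data.List.Relation.Unary.Linked.Properties using (Linked⇒AllPairs; AllPairs⇒Linked)
open import Data.List.Relation.Unary.Unique.Propositional using (Unique)
import Data.List.Relation.Unary.Unique.Propositional.Properties as Unique
open import Data.Nat.Base as ℕ using (ℕ; zero; suc; _≤_; _<_; _≥_; _>_; z≤n; s≤s; ⌈_/2⌉; ⌊_/2⌋)
open import Data.Nat.Combinatorics using (_C_; nC1≡n; nCk+nC[k+1]≡[n+1]C[k+1])
open import Data.Nat.DivMod using (_%_; [m+kn]%n≡m%n)
open import Data.Nat.Induction using (<-rec)
open import Data.Nat.ListAction using (sum)
open import Data.Nat.ListAction.Properties using (sum-++; sum-↭)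
import Data.Nat.Properties as ℕ
open import Data.Nat.Solver using (module +-*-Solver)
open import Data.Product.Base using (_×_; _,_; ∃; proj₁; proj₂)
open import Data.Sum.Base using (inj₁; inj₂)
open import Function.Base using (_∘_)
open import Level using (0ℓ)
open import Relation.Binary.Bundles using (Setoid)
open import Relation.Binary.PropositionalEquality as ≡ using (_≡_; _≢_; _≗_)
open import Relation.Nullary.Decidable.Core using (Dec; yes; no; _×-dec_)
open import Relation.Nullary.Negation using (contradiction)
open import Relation.Unary using (Decidable)

-- Rounding an odd L up to the next even number keeps ⌈L/2⌉ and can only enlarge the distinct side;
-- hence L = 2K. The factor P · h₂ arises because distinct odd parts differ by at least two: a part
-- of size at least 3 creates one hook of length two when it occurs once, and two hooks when it is
-- repeated. Adding two parts from 3, 5, ..., 2K-1, equal or not, to any odd partition therefore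
-- provides two hooks to mark. On the distinct side a part k ≥ 2 creates a hook exactly when k-1 is
-- absent, which gives linear recurrences whose solutions factor. The argument passes from q to q²,
-- so the identities are proved for an arbitrary element of an arbitrary commutative semiring, and
-- power series enter only at the end. Such a semiring has no subtraction, no division and no
-- infinite sums. The order is therefore the existence of a difference, Gaussian binomials are given
-- by recurrences, and P is cut off at multiplicity N, with N depending on K.

n≤⌈n/2⌉*2 : ∀ n → n ℕ.≤ ⌈ n /2⌉ ℕ.* 2
n≤⌈n/2⌉*2 zero          = z≤n
n≤⌈n/2⌉*2 (suc zero)    = s≤s z≤n
n≤⌈n/2⌉*2 (suc (suc n)) = s≤s (s≤s (n≤⌈n/2⌉*2 n))

-- The algebraic order of a commutative semiring

module NaturalOrder {ℓ₁ ℓ₂} (R : CommutativeSemiring ℓ₁ ℓ₂) where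

  open CommutativeSemiring R
  open import Algebra.Solver.Ring.NaturalCoefficients.Default R
  open import Relation.Binary.Reasoning.Setoid setoid

  infix 4 _≼_

  -- For power series over the natural numbers this is the coefficientwise order. Carrying the
  -- difference as a witness turns inequalities into identities for the ring solver.
  _≼_ : Carrier → Carrier → Set _
  x ≼ y = ∃ λ z → x + z ≈ y

  ≈⇒≼ : ∀ {x y} → x ≈ y → x ≼ y
  ≈⇒≼ x≈y = 0# , trans (+-identityʳ _) x≈y

  ≼-refl : ∀ {x} → x ≼ x
  ≼-refl = ≈⇒≼ refl

  ≼-trans : ∀ {x y z} → x ≼ y → y ≼ z → x ≼ z
  ≼-trans (u , x+u≈y) (v , y+v≈z) =
    u + v , trans (sym (+-assoc _ u v)) (trans (+-congʳ x+u≈y) y+v≈z)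

  ≼-respˡ : ∀ {x y z} → x ≈ y → y ≼ z → x ≼ z
  ≼-respˡ x≈y y≼z = ≼-trans (≈⇒≼ x≈y) y≼z

  ≼-respʳ : ∀ {x y z} → x ≼ y → y ≈ z → x ≼ z
  ≼-respʳ x≼y y≈z = ≼-trans x≼y (≈⇒≼ y≈z)

  0≼x : ∀ {x} → 0# ≼ x
  0≼x = _ , +-identityˡ _

  x≼x+y : ∀ {x y} → x ≼ x + y
  x≼x+y = _ , refl

  +-mono-≼ : ∀ {x y u v} → x ≼ y → u ≼ v → x + u ≼ y + v
  +-mono-≼ {x} {y} {u} {v} (a , x+a≈y) (b , u+b≈v) = a + b , (begin
    (x + u) + (a + b)  ≈⟨ solve 4 (λ x u a b → (x :+ u) :+ (a :+ b) := (x :+ a) :+ (u :+ b)) refl x u a b ⟩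
    (x + a) + (u + b)  ≈⟨ +-cong x+a≈y u+b≈v ⟩
    y + v              ∎)

  *-mono-≼ : ∀ {x y u v} → x ≼ y → u ≼ v → x * u ≼ y * v
  *-mono-≼ {x} {y} {u} {v} (a , x+a≈y) (b , u+b≈v) = x * b + a * v , (begin
    x * u + (x * b + a * v)        ≈⟨ solve 5 (λ x u a b v → x :* u :+ (x :* b :+ a :* v) := x :* (u :+ b) :+ a :* v) refl x u a b v ⟩
    x * (u + b) + a * v            ≈⟨ +-congʳ (*-congˡ u+b≈v) ⟩
    x * v + a * v                  ≈⟨ distribʳ v x a ⟨
    (x + a) * v                    ≈⟨ *-congʳ x+a≈y ⟩
    y * v                          ∎)

  *-monoˡ-≼ : ∀ {x u v} → u ≼ v → x * u ≼ x * v
  *-monoˡ-≼ = *-mono-≼ ≼-refl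

-- Gaussian binomials, finite products and Glaisher's inequality

module QCalculus {ℓ₁ ℓ₂} (R : CommutativeSemiring ℓ₁ ℓ₂) where

  open CommutativeSemiring R
  open NaturalOrder R
  open import Algebra.Properties.Semiring.Exp semiring
  open import Algebra.Solver.Ring.NaturalCoefficients.Default R
  open import Relation.Binary.Reasoning.Setoid setoid

  square-^ : ∀ x n → (x * x) ^ n ≈ x ^ (n ℕ.* 2)
  square-^ x zero    = refl
  square-^ x (suc n) = trans (*-assoc x x _) (*-congˡ (*-congˡ (square-^ x n)))

  [_]⟨_⟩ : ℕ → Carrier → Carrier
  [ zero  ]⟨ x ⟩ = 0#
  [ suc n ]⟨ x ⟩ = 1# + x * [ n ]⟨ x ⟩

  -- the Gaussian binomial coefficient n over 2
  binom₂⟨_⟩ : Carrier → ℕ → Carrier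
  binom₂⟨ x ⟩ zero    = 0#
  binom₂⟨ x ⟩ (suc n) = x * x * binom₂⟨ x ⟩ n + [ n ]⟨ x ⟩

  []-suc : ∀ x n → [ suc n ]⟨ x ⟩ ≈ [ n ]⟨ x ⟩ + x ^ n
  []-suc x zero    = solve 1 (λ x → con 1 :+ x :* con 0 := con 0 :+ con 1) refl x
  []-suc x (suc n) = begin
    1# + x * [ suc n ]⟨ x ⟩          ≈⟨ +-congˡ (*-congˡ ([]-suc x n)) ⟩
    1# + x * ([ n ]⟨ x ⟩ + x ^ n)    ≈⟨ solve 3 (λ x b p → con 1 :+ x :* (b :+ p) := (con 1 :+ x :* b) :+ x :* p) refl x [ n ]⟨ x ⟩ (x ^ n) ⟩
    [ suc n ]⟨ x ⟩ + x ^ suc n       ∎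

  -- The q-Pascal rule dual to the one that defines `binom₂⟨_⟩`; the closed forms below use both.
  binom₂-suc : ∀ x n → binom₂⟨ x ⟩ (suc (suc n)) ≈ binom₂⟨ x ⟩ (suc n) + x ^ n * [ suc n ]⟨ x ⟩
  binom₂-suc x zero    = solve 1 (λ x → x :* x :* (x :* x :* con 0 :+ con 0) :+ (con 1 :+ x :* con 0)
                                   := (x :* x :* con 0 :+ con 0) :+ con 1 :* (con 1 :+ x :* con 0)) refl x
  binom₂-suc x (suc n) = begin
    x * x * binom₂⟨ x ⟩ (suc (suc n)) + [ suc (suc n) ]⟨ x ⟩
      ≈⟨ +-cong (*-congˡ (binom₂-suc x n)) ([]-suc x (suc n)) ⟩
    x * x * (c + p * b) + (b + x * p)
      ≈⟨ solve 4 (λ x c p b → x :* x :* (c :+ p :* b) :+ (b :+ x :* p)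
                  := (x :* x :* c :+ b) :+ x :* p :* (con 1 :+ x :* b)) refl x c p b ⟩
    binom₂⟨ x ⟩ (suc (suc n)) + x ^ suc n * [ suc (suc n) ]⟨ x ⟩ ∎
    where
    c = binom₂⟨ x ⟩ (suc n)
    p = x ^ n
    b = [ suc n ]⟨ x ⟩

  -- Consecutive powers are paired. Doubling is written `n ℕ.* 2` so that `suc n ℕ.* 2` reduces to
  -- two successors.
  []-double : ∀ x n → [ n ℕ.* 2 ]⟨ x ⟩ ≈ (1# + x) * [ n ]⟨ x * x ⟩
  []-double x zero    = sym (zeroʳ _)
  []-double x (suc n) = begin
    1# + x * (1# + x * [ n ℕ.* 2 ]⟨ x ⟩)          ≈⟨ +-congˡ (*-congˡ (+-congˡ (*-congˡ ([]-double x n)))) ⟩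
    1# + x * (1# + x * ((1# + x) * [ n ]⟨ x * x ⟩)) ≈⟨ solve 2 (λ x b → con 1 :+ x :* (con 1 :+ x :* ((con 1 :+ x) :* b)) := (con 1 :+ x) :* (con 1 :+ x :* x :* b)) refl x [ n ]⟨ x * x ⟩ ⟩
    (1# + x) * [ suc n ]⟨ x * x ⟩                 ∎

  []-mono : ∀ x n → [ n ]⟨ x ⟩ ≼ [ suc n ]⟨ x ⟩
  []-mono x n = _ , sym ([]-suc x n)

  -- For n ≥ 1 in quotient form, the left side is [2n-1] in base x times [n] in base x², and the
  -- right side is [2n+2] in base x times [n] in base x². Without division, the induction sets two
  -- Pascal steps on the left against one on the right, with [2n] and [2n+1] both raised to [2n+2].
  binom₂-double-≼ : ∀ x n →
    binom₂⟨ x ⟩ (n ℕ.* 2) ≼ (1# + x) * (1# + x * x) * binom₂⟨ x * x ⟩ (suc n)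
  binom₂-double-≼ x zero    = 0≼x
  binom₂-double-≼ x (suc n) = ≼-trans
    (+-mono-≼ (*-monoˡ-≼ (+-mono-≼ (*-monoˡ-≼ (binom₂-double-≼ x n))
                                   (≼-trans ([]-mono x (n ℕ.* 2)) ([]-mono x (suc (n ℕ.* 2))))))
              ([]-mono x (suc (n ℕ.* 2))))
    (≈⇒≼ (begin
      x * x * (x * x * (y * c) + [ suc n ℕ.* 2 ]⟨ x ⟩) + [ suc n ℕ.* 2 ]⟨ x ⟩
        ≈⟨ +-cong (*-congˡ (+-congˡ ([]-double x (suc n)))) ([]-double x (suc n)) ⟩
      x * x * (x * x * (y * c) + (1# + x) * b) + (1# + x) * b
        ≈⟨ solve 3 (λ x c b → let y = (con 1 :+ x) :* (con 1 :+ x :* x) in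
             x :* x :* (x :* x :* (y :* c) :+ (con 1 :+ x) :* b) :+ (con 1 :+ x) :* b
             := y :* ((x :* x) :* (x :* x) :* c :+ b)) refl x c b ⟩
      y * binom₂⟨ x * x ⟩ (suc (suc n)) ∎))
    where
    y = (1# + x) * (1# + x * x)
    c = binom₂⟨ x * x ⟩ (suc n)
    b = [ suc n ]⟨ x * x ⟩

  -- ∏ (1 + xᵏ) over a < k ≤ a + n
  rising : Carrier → ℕ → ℕ → Carrier
  rising x a zero    = 1#
  rising x a (suc n) = rising x a n * (1# + x ^ suc (a ℕ.+ n))

  rising-suc : ∀ x a n → rising x a (suc n) ≈ (1# + x ^ suc a) * rising x (suc a) n
  rising-suc x a zero    = trans (*-comm _ _) (*-congʳ (+-congˡ (^-congʳ x (≡.cong suc (ℕ.+-identityʳ a)))))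
  rising-suc x a (suc n) = begin
    rising x a (suc n) * (1# + x ^ suc (a ℕ.+ suc n))
      ≈⟨ *-cong (rising-suc x a n) (+-congˡ (^-congʳ x (≡.cong suc (ℕ.+-suc a n)))) ⟩
    (1# + x ^ suc a) * rising x (suc a) n * (1# + x ^ suc (suc a ℕ.+ n))
      ≈⟨ *-assoc _ _ _ ⟩
    (1# + x ^ suc a) * rising x (suc a) (suc n) ∎

  risingOdd : Carrier → ℕ → Carrier
  risingOdd x zero    = 1#
  risingOdd x (suc n) = risingOdd x n * (1# + x ^ suc (n ℕ.* 2))

  rising-double : ∀ x n → rising x 0 (n ℕ.* 2) ≈ risingOdd x n * rising (x * x) 0 n
  rising-double x zero    = sym (*-identityˡ 1#)
  rising-double x (suc n) = begin
    rising x 0 (n ℕ.* 2) * (1# + x ^ suc (n ℕ.* 2)) * (1# + x ^ (suc n ℕ.* 2))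
      ≈⟨ *-cong (*-congʳ (rising-double x n)) (+-congˡ (sym (square-^ x (suc n)))) ⟩
    risingOdd x n * rising (x * x) 0 n * (1# + x ^ suc (n ℕ.* 2)) * (1# + (x * x) ^ suc n)
      ≈⟨ solve 4 (λ o d u v → o :* d :* u :* v := o :* u :* (d :* v)) refl _ _ _ _ ⟩
    risingOdd x (suc n) * rising (x * x) 0 (suc n) ∎

  geom : ℕ → Carrier → Carrier
  geom zero    x = 1#
  geom (suc N) x = 1# + x * geom N x

  geom-cong : ∀ N {x y} → x ≈ y → geom N x ≈ geom N y
  geom-cong zero    x≈y = refl
  geom-cong (suc N) x≈y = +-congˡ (*-cong x≈y (geom-cong N x≈y))

  geom-mono : ∀ N x → geom N x ≼ geom (suc N) x
  geom-mono zero    x = x≼x+y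
  geom-mono (suc N) x = +-mono-≼ ≼-refl (*-monoˡ-≼ (geom-mono N x))

  1≼geom : ∀ N x → 1# ≼ geom N x
  1≼geom zero    x = ≼-refl
  1≼geom (suc N) x = x≼x+y

  geom-double : ∀ N x → geom (suc (N ℕ.* 2)) x ≈ (1# + x) * geom N (x * x)
  geom-double zero    x = solve 1 (λ x → con 1 :+ x :* con 1 := (con 1 :+ x) :* con 1) refl x
  geom-double (suc N) x = begin
    1# + x * (1# + x * geom (suc (N ℕ.* 2)) x)
      ≈⟨ +-congˡ (*-congˡ (+-congˡ (*-congˡ (geom-double N x)))) ⟩
    1# + x * (1# + x * ((1# + x) * geom N (x * x)))
      ≈⟨ solve 2 (λ x g → con 1 :+ x :* (con 1 :+ x :* ((con 1 :+ x) :* g)) := (con 1 :+ x) :* (con 1 :+ x :* x :* g)) refl x (geom N (x * x)) ⟩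
    (1# + x) * geom (suc N) (x * x) ∎

  -- The generating function of partitions into odd parts below 2n in which each part occurs at most
  -- N times; it stands in for the infinite product.
  geomOdd : ℕ → Carrier → ℕ → Carrier
  geomOdd N x zero    = 1#
  geomOdd N x (suc n) = geomOdd N x n * geom N (x ^ suc (n ℕ.* 2))

  geomOdd-double : ∀ N x n →
    geomOdd (suc (N ℕ.* 2)) x n ≈ risingOdd x n * geomOdd N (x * x) n
  geomOdd-double N x zero    = sym (*-identityˡ 1#)
  geomOdd-double N x (suc n) = begin
    geomOdd (suc (N ℕ.* 2)) x n * geom (suc (N ℕ.* 2)) y
      ≈⟨ *-cong (geomOdd-double N x n) (geom-double N y) ⟩
    risingOdd x n * geomOdd N (x * x) n * ((1# + y) * geom N (y * y))
      ≈⟨ *-congˡ (*-congˡ (geom-cong N (^-square (suc (n ℕ.* 2))))) ⟩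
    risingOdd x n * geomOdd N (x * x) n * ((1# + y) * geom N ((x * x) ^ suc (n ℕ.* 2)))
      ≈⟨ solve 4 (λ o d u v → o :* d :* (u :* v) := o :* u :* (d :* v)) refl _ _ _ _ ⟩
    risingOdd x (suc n) * geomOdd N (x * x) (suc n) ∎
    where
    y = x ^ suc (n ℕ.* 2)

    ^-square : ∀ k → x ^ k * x ^ k ≈ (x * x) ^ k
    ^-square k = begin
      x ^ k * x ^ k    ≈⟨ ^-homo-* x k k ⟨
      x ^ (k ℕ.+ k)    ≈⟨ ^-congʳ x (≡.trans (≡.cong (k ℕ.+_) (≡.sym (ℕ.+-identityʳ k))) (ℕ.*-comm 2 k)) ⟩
      x ^ (k ℕ.* 2)    ≈⟨ square-^ x k ⟨
      (x * x) ^ k      ∎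

  rising-mono : ∀ x a {m n} → m ℕ.≤ n → rising x a m ≼ rising x a n
  rising-mono x a m≤n = go (ℕ.≤⇒≤′ m≤n)
    where
    go : ∀ {m n} → m ℕ.≤′ n → rising x a m ≼ rising x a n
    go (ℕ.≤′-reflexive ≡.refl) = ≼-refl
    go (ℕ.≤′-step m≤n) = ≼-trans (go m≤n) (≼-respˡ (sym (*-identityʳ _)) (*-monoˡ-≼ x≼x+y))

  geomOdd-mono : ∀ N x {m n} → m ℕ.≤ n → geomOdd N x m ≼ geomOdd N x n
  geomOdd-mono N x m≤n = go (ℕ.≤⇒≤′ m≤n)
    where
    go : ∀ {m n} → m ℕ.≤′ n → geomOdd N x m ≼ geomOdd N x n
    go (ℕ.≤′-reflexive ≡.refl) = ≼-refl
    go (ℕ.≤′-step m≤n) = ≼-trans (go m≤n) (≼-respˡ (sym (*-identityʳ _)) (*-monoˡ-≼ (1≼geom N _)))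

  -- Glaisher's correspondence: splitting off the odd parts leaves doubled
  -- distinct parts, and (1 + y)(1 + y² + ⋯ + y²ᴺ) = 1 + y + ⋯ + y²ᴺ⁺¹.
  rising≼geomOdd : ∀ n → ∃ λ N → ∀ x → rising x 0 (n ℕ.* 2) ≼ geomOdd N x n
  rising≼geomOdd = <-rec _ λ where
    0 _ → 0 , λ x → ≼-refl
    -- Halving with rounding up fixes 1, so this case is a base: (1 + x)(1 + x²) = 1 + x + x² + x³.
    1 _ → 3 , λ x → ≈⇒≼ (solve 1 (λ x →
      con 1 :* (con 1 :+ x :* con 1) :* (con 1 :+ x :* (x :* con 1)) :=
      con 1 :* (con 1 :+ x :* con 1 :* (con 1 :+ x :* con 1 :* (con 1 :+ x :* con 1 :* con 1)))) refl x)
    -- The hypothesis is applied at `x * x`, so N has to be chosen before x.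
    n@(suc (suc k)) rec → let N , h = rec {⌈ n /2⌉} (ℕ.⌈n/2⌉<n k) in
      suc (N ℕ.* 2) , λ x →
      ≼-respˡ (rising-double x n) (≼-respʳ
        (*-monoˡ-≼ (≼-trans (rising-mono (x * x) 0 (n≤⌈n/2⌉*2 n))
                   (≼-trans (h (x * x)) (geomOdd-mono N (x * x) (ℕ.⌈n/2⌉≤n n)))))
        (sym (geomOdd-double N x n)))

-- Hooks of length two

hookLength-≥3 : ∀ p ps {j} → j < p → hookLength (2 ℕ.+ p) ps j ≢ 2
hookLength-≥3 p ps {j} j<p h≡2 = ℕ.<⇒≱ (s≤s (s≤s (s≤s z≤n))) (≡.subst (3 ≤_) h≡2
  (ℕ.m≤n⇒m≤n+o (length (filter (j ℕ.<?_) ps)) (s≤s (ℕ.≤-trans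
    (ℕ.≤-reflexive (≡.sym (ℕ.m+n∸n≡m 2 p))) (ℕ.∸-monoʳ-≤ (2 ℕ.+ p) j<p)))))

-- The leg of the cell in column `p`, counted from 0, above the rows `ps`.
exceeding : ℕ → List ℕ → ℕ
exceeding p ps = length (filter (p ℕ.<?_) ps)

-- Only the last two cells of the first row can have hook length two.
hooks₂-∷ : ∀ p ps {a b} → exceeding p ps ≡ a → exceeding (suc p) ps ≡ b →
  hooks₂ (2 ℕ.+ p ∷ ps) ≡ length (filter (ℕ._≟ 2) (2 ℕ.+ a ∷ 1 ℕ.+ b ∷ [])) ℕ.+ hooks₂ ps
hooks₂-∷ p ps ≡.refl ≡.refl = begin
  length (filter (ℕ._≟ 2) (map h (upTo (2 ℕ.+ p)) ++ hookLengths ps))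
    ≡⟨ ≡.cong length (List.filter-++ (ℕ._≟ 2) (map h (upTo (2 ℕ.+ p))) (hookLengths ps)) ⟩
  length (filter (ℕ._≟ 2) (map h (upTo (2 ℕ.+ p))) ++ filter (ℕ._≟ 2) (hookLengths ps))
    ≡⟨ List.length-++ (filter (ℕ._≟ 2) (map h (upTo (2 ℕ.+ p)))) ⟩
  length (filter (ℕ._≟ 2) (map h (upTo (2 ℕ.+ p)))) ℕ.+ hooks₂ ps
    ≡⟨ ≡.cong (λ hs → length hs ℕ.+ hooks₂ ps) row ⟩
  _ ∎
  where
  open ≡.≡-Reasoning
  h = hookLength (2 ℕ.+ p) ps

  upTo-2+ : upTo (2 ℕ.+ p) ≡ upTo p ++ p ∷ suc p ∷ []
  upTo-2+ = begin
    upTo (2 ℕ.+ p)                         ≡⟨ List.upTo-∷ʳ (suc p) ⟨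
    upTo (suc p) ++ suc p ∷ []             ≡⟨ ≡.cong (_++ suc p ∷ []) (List.upTo-∷ʳ p) ⟨
    (upTo p ++ p ∷ []) ++ suc p ∷ []       ≡⟨ List.++-assoc (upTo p) (p ∷ []) (suc p ∷ []) ⟩
    upTo p ++ p ∷ suc p ∷ []               ∎

  row : filter (ℕ._≟ 2) (map h (upTo (2 ℕ.+ p))) ≡
        filter (ℕ._≟ 2) (2 ℕ.+ exceeding p ps ∷
                         1 ℕ.+ exceeding (suc p) ps ∷ [])
  row = begin
    filter (ℕ._≟ 2) (map h (upTo (2 ℕ.+ p)))
      ≡⟨ ≡.cong (filter (ℕ._≟ 2)) (≡.trans (≡.cong (map h) upTo-2+) (List.map-++ h (upTo p) (p ∷ suc p ∷ []))) ⟩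
    filter (ℕ._≟ 2) (map h (upTo p) ++ h p ∷ h (suc p) ∷ [])
      ≡⟨ List.filter-++ (ℕ._≟ 2) (map h (upTo p)) (h p ∷ h (suc p) ∷ []) ⟩
    filter (ℕ._≟ 2) (map h (upTo p)) ++ filter (ℕ._≟ 2) (h p ∷ h (suc p) ∷ [])
      ≡⟨ ≡.cong (_++ filter (ℕ._≟ 2) (h p ∷ h (suc p) ∷ [])) (List.filter-none (ℕ._≟ 2)
           (All.map⁺ (All.map (hookLength-≥3 p ps) (All.all-upTo p)))) ⟩
    filter (ℕ._≟ 2) (h p ∷ h (suc p) ∷ [])
      ≡⟨ ≡.cong₂ (λ a b → filter (ℕ._≟ 2) (suc a ℕ.+ exceeding p ps ∷
                                           suc b ℕ.+ exceeding (suc p) ps ∷ []))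
           (ℕ.m+n∸n≡m 1 p) (ℕ.n∸n≡0 p) ⟩
    _ ∎

-- Hooks extend to the right and downwards, so a new top row leaves the hooks below it unchanged.
hooks₂-mono-∷ : ∀ p ps → hooks₂ ps ≤ hooks₂ (p ∷ ps)
hooks₂-mono-∷ p ps = begin
  hooks₂ ps
    ≤⟨ ℕ.m≤n+m (hooks₂ ps) _ ⟩
  length (filter (ℕ._≟ 2) row) ℕ.+ hooks₂ ps
    ≡⟨ List.length-++ (filter (ℕ._≟ 2) row) ⟨
  length (filter (ℕ._≟ 2) row ++ filter (ℕ._≟ 2) (hookLengths ps))
    ≡⟨ ≡.cong length (List.filter-++ (ℕ._≟ 2) row (hookLengths ps)) ⟨
  hooks₂ (p ∷ ps) ∎
  where
  open ℕ.≤-Reasoning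
  row = map (hookLength p ps) (upTo p)

exceeding-none : ∀ {p ps} → All (_≤ p) ps → exceeding p ps ≡ 0
exceeding-none {p} ps≤p =
  ≡.cong length (List.filter-none (p ℕ.<?_) (All.map ℕ.≤⇒≯ ps≤p))

exceeding-∷ : ∀ {p q} ps → p < q → exceeding p (q ∷ ps) ≡ suc (exceeding p ps)
exceeding-∷ {p} ps p<q = ≡.cong length (List.filter-accept (p ℕ.<?_) {xs = ps} p<q)

bounded-suc : ∀ {p ps} → All (_≤ p) ps → All (_≤ suc p) ps
bounded-suc = All.map ℕ.m≤n⇒m≤1+n

-- No lower row reaches the last two columns: the last two cells have hook lengths 2 and 1.
hooks₂-gap : ∀ {p ps} → All (_≤ p) ps → hooks₂ (2 ℕ.+ p ∷ ps) ≡ suc (hooks₂ ps)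
hooks₂-gap {p} {ps} ps≤p =
  hooks₂-∷ p ps (exceeding-none ps≤p) (exceeding-none (bounded-suc ps≤p))

-- The row below lies under the penultimate cell but not under the last one, so their hook lengths
-- are 3 and 1.
hooks₂-consecutive : ∀ {p ps} → All (_≤ p) ps →
  hooks₂ (2 ℕ.+ p ∷ 1 ℕ.+ p ∷ ps) ≡ hooks₂ (1 ℕ.+ p ∷ ps)
hooks₂-consecutive {p} {ps} ps≤p = hooks₂-∷ p (1 ℕ.+ p ∷ ps)
  (≡.trans (exceeding-∷ ps (ℕ.n<1+n p)) (≡.cong suc (exceeding-none ps≤p)))
  (exceeding-none (ℕ.≤-refl ∷ bounded-suc ps≤p))

-- In the upper copy the last two cells have hook lengths 3 and 2; the lower copy has a gap below
-- it.
hooks₂-repeated : ∀ {p ps} → All (_≤ p) ps →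
  hooks₂ (2 ℕ.+ p ∷ 2 ℕ.+ p ∷ ps) ≡ 2 ℕ.+ hooks₂ ps
hooks₂-repeated {p} {ps} ps≤p = ≡.trans
  (hooks₂-∷ p (2 ℕ.+ p ∷ ps)
    (≡.trans (exceeding-∷ ps (ℕ.m≤n⇒m≤1+n (ℕ.n<1+n p))) (≡.cong suc (exceeding-none ps≤p)))
    (≡.trans (exceeding-∷ ps (ℕ.n<1+n (suc p))) (≡.cong suc (exceeding-none (bounded-suc ps≤p)))))
  (≡.cong suc (hooks₂-gap ps≤p))

hooks₂-replicate-≥1 : ∀ {p ps} → All (_≤ p) ps → ∀ m →
  1 ℕ.+ hooks₂ ps ≤ hooks₂ (2 ℕ.+ p ∷ replicate m (2 ℕ.+ p) ++ ps)
hooks₂-replicate-≥1 ps≤p zero    = ℕ.≤-reflexive (≡.sym (hooks₂-gap ps≤p))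
hooks₂-replicate-≥1 {p} {ps} ps≤p (suc m) = ℕ.≤-trans (hooks₂-replicate-≥1 ps≤p m)
  (hooks₂-mono-∷ (2 ℕ.+ p) (replicate (suc m) (2 ℕ.+ p) ++ ps))

hooks₂-replicate-≥2 : ∀ {p ps} → All (_≤ p) ps → ∀ m →
  2 ℕ.+ hooks₂ ps ≤ hooks₂ (2 ℕ.+ p ∷ 2 ℕ.+ p ∷ replicate m (2 ℕ.+ p) ++ ps)
hooks₂-replicate-≥2 ps≤p zero    = ℕ.≤-reflexive (≡.sym (hooks₂-repeated ps≤p))
hooks₂-replicate-≥2 {p} {ps} ps≤p (suc m) = ℕ.≤-trans (hooks₂-replicate-≥2 ps≤p m)
  (hooks₂-mono-∷ (2 ℕ.+ p) (replicate (2 ℕ.+ m) (2 ℕ.+ p) ++ ps))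

[1+n]C2≡n+nC2 : ∀ n → suc n C 2 ≡ n ℕ.+ n C 2
[1+n]C2≡n+nC2 n = ≡.trans (≡.sym (nCk+nC[k+1]≡[n+1]C[k+1] n 1)) (≡.cong (ℕ._+ n C 2) (nC1≡n n))

C2-mono : ∀ {m n} → m ≤ n → m C 2 ≤ n C 2
C2-mono m≤n = go (ℕ.≤⇒≤′ m≤n)
  where
  go : ∀ {m n} → m ℕ.≤′ n → m C 2 ≤ n C 2
  go (ℕ.≤′-reflexive ≡.refl) = ℕ.≤-refl
  go (ℕ.≤′-step {n} m≤n) = ℕ.≤-trans (go m≤n)
    (ℕ.≤-trans (ℕ.m≤n+m (n C 2) n) (ℕ.≤-reflexive (≡.sym ([1+n]C2≡n+nC2 n))))

-- Partitions into distinct parts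

-- Splitting by whether the largest admissible part occurs is the case distinction between
-- `hooks₂-gap` and `hooks₂-consecutive`.
distinctLists : ℕ → List (List ℕ)
distinctLists zero    = [] ∷ []
distinctLists (suc n) = distinctLists n ++ map (suc n ∷_) (distinctLists n)

distinctLists-bounded : ∀ n {ps} → ps ∈ distinctLists n → All (_≤ n) ps
distinctLists-bounded zero    (here ≡.refl) = []
distinctLists-bounded (suc n) ps∈ with ∈-++⁻ (distinctLists n) ps∈
... | inj₁ ps∈′ = All.map ℕ.m≤n⇒m≤1+n (distinctLists-bounded n ps∈′)
... | inj₂ ps∈′ with ∈-map⁻ (suc n ∷_) ps∈′
...   | qs , qs∈ , ≡.refl = ℕ.≤-refl ∷ All.map ℕ.m≤n⇒m≤1+n (distinctLists-bounded n qs∈)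

distinctLists-complete : ∀ n {ps} → AllPairs _>_ ps → All (0 <_) ps → All (_≤ n) ps →
                         ps ∈ distinctLists n
distinctLists-complete zero    []      []          []         = here ≡.refl
distinctLists-complete zero    (_ ∷ _) (0<p ∷ _)   (p≤0 ∷ _)  = contradiction p≤0 (ℕ.<⇒≱ 0<p)
distinctLists-complete (suc n) []      []          []         =
  ∈-++⁺ˡ (distinctLists-complete n [] [] [])
distinctLists-complete (suc n) (p> ∷ ps>) (0<p ∷ 0<ps) (p≤ ∷ ps≤) with ℕ.m≤n⇒m<n∨m≡n p≤
... | inj₁ p<1+n = ∈-++⁺ˡ (distinctLists-complete n (p> ∷ ps>) (0<p ∷ 0<ps)
        (ℕ.≤-pred p<1+n ∷ All.map (λ q<p → ℕ.≤-pred (ℕ.≤-trans q<p p≤)) p>))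
... | inj₂ ≡.refl = ∈-++⁺ʳ (distinctLists n) (∈-map⁺ (suc n ∷_)
        (distinctLists-complete n ps> 0<ps (All.map ℕ.≤-pred p>)))

-- Partitions into odd parts

-- Multiplicities are bounded by N to keep the lists finite; this suffices because
-- the odd side only has to be bounded below, by a polynomial in q.
withCopies : ℕ → ℕ → List (List ℕ) → List (List ℕ)
withCopies p zero    pss = pss
withCopies p (suc N) pss = pss ++ map (p ∷_) (withCopies p N pss)

oddLists : ℕ → ℕ → List (List ℕ)
oddLists N zero    = [] ∷ []
oddLists N (suc k) = withCopies (suc (k ℕ.* 2)) N (oddLists N k)

withCopies-induction : ∀ {P : List ℕ → Set} p N {pss} → (∀ {ps} → ps ∈ pss → P ps) →
  (∀ {ps} → P ps → P (p ∷ ps)) → ∀ {ps} → ps ∈ withCopies p N pss → P ps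
withCopies-induction p zero    base step ps∈ = base ps∈
withCopies-induction p (suc N) {pss} base step ps∈ with ∈-++⁻ pss ps∈
... | inj₁ ps∈′ = base ps∈′
... | inj₂ ps∈′ with ∈-map⁻ (p ∷_) ps∈′
...   | qs , qs∈ , ≡.refl = step (withCopies-induction p N base step qs∈)

withCopies-unique : ∀ p N {pss} → Unique pss → (∀ {ps} → p ∷ ps ∉ pss) →
                    Unique (withCopies p N pss)
withCopies-unique p zero    pss! p∷∉ = pss!
withCopies-unique p (suc N) {pss} pss! p∷∉ =
  Unique.++⁺ pss! (Unique.map⁺ List.∷-injectiveʳ (withCopies-unique p N pss! p∷∉)) disjoint
  where
  disjoint : ∀ {ps} → ps ∈ pss × ps ∈ map (p ∷_) (withCopies p N pss) → ⊥
  disjoint (l , r) with ∈-map⁻ (p ∷_) r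
  ... | _ , _ , ≡.refl = p∷∉ l

oddLists-sound : ∀ N k {ps} → ps ∈ oddLists N k →
  AllPairs _≥_ ps × All (λ p → p % 2 ≡ 1 × p < k ℕ.* 2) ps
oddLists-sound N zero    (here ≡.refl) = [] , []
oddLists-sound N (suc k) ps∈ = withCopies-induction (suc (k ℕ.* 2)) N
  (λ qs∈ → let sorted , odd = oddLists-sound N k qs∈ in
    sorted , All.map (λ (q%2≡1 , q<) → q%2≡1 , ℕ.m≤n⇒m≤o+n 2 q<) odd)
  (λ (sorted , odd) →
    All.map (λ (_ , q<) → ℕ.≤-pred q<) odd ∷ sorted , ([m+kn]%n≡m%n 1 k 2 , ℕ.≤-refl) ∷ odd)
  ps∈

oddLists-unique : ∀ N k → Unique (oddLists N k)
oddLists-unique N zero    = [] ∷ []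
oddLists-unique N (suc k) = withCopies-unique (suc (k ℕ.* 2)) N (oddLists-unique N k)
  λ p∷∈ → ℕ.<⇒≯ (ℕ.n<1+n (k ℕ.* 2)) (proj₂ (All.head (proj₂ (oddLists-sound N k p∷∈))))

-- Generating functions

one hookPairs : List ℕ → ℕ
one       _  = 1
hookPairs ps = hooks₂ ps C 2

module GeneratingFunctions {ℓ₁ ℓ₂} (R : CommutativeSemiring ℓ₁ ℓ₂) (q : CommutativeSemiring.Carrier R) where

  open CommutativeSemiring R
  open NaturalOrder R
  open QCalculus R
  open import Algebra.Properties.Semiring.Exp semiring
  open import Algebra.Properties.Semiring.Mult semiring
    using (×-congˡ; ×-congʳ; ×-homo-+; ×-comm-*) renaming (_×_ to _·_)
  open import Algebra.Solver.Ring.NaturalCoefficients.Default R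
  open import Relation.Binary.Reasoning.Setoid setoid

  genFun : (List ℕ → ℕ) → List (List ℕ) → Carrier
  genFun w []         = 0#
  genFun w (ps ∷ pss) = w ps · q ^ sum ps + genFun w pss

  genFun-++ : ∀ w pss {qss} → genFun w (pss ++ qss) ≈ genFun w pss + genFun w qss
  genFun-++ w []         = sym (+-identityˡ _)
  genFun-++ w (ps ∷ pss) = trans (+-congˡ (genFun-++ w pss)) (sym (+-assoc _ _ _))

  genFun-map-∷ : ∀ w p pss → genFun w (map (p ∷_) pss) ≈ q ^ p * genFun (w ∘ (p ∷_)) pss
  genFun-map-∷ w p []         = sym (zeroʳ _)
  genFun-map-∷ w p (ps ∷ pss) = begin
    w (p ∷ ps) · q ^ (p ℕ.+ sum ps) + genFun w (map (p ∷_) pss)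
      ≈⟨ +-cong (×-congʳ (w (p ∷ ps)) (^-homo-* q p (sum ps))) (genFun-map-∷ w p pss) ⟩
    w (p ∷ ps) · (q ^ p * q ^ sum ps) + q ^ p * genFun (w ∘ (p ∷_)) pss
      ≈⟨ +-congʳ (×-comm-* (w (p ∷ ps)) (q ^ p) (q ^ sum ps)) ⟨
    q ^ p * (w (p ∷ ps) · q ^ sum ps) + q ^ p * genFun (w ∘ (p ∷_)) pss
      ≈⟨ distribˡ _ _ _ ⟨
    q ^ p * genFun (w ∘ (p ∷_)) (ps ∷ pss) ∎

  genFun-+ : ∀ v w pss → genFun (λ ps → v ps ℕ.+ w ps) pss ≈ genFun v pss + genFun w pss
  genFun-+ v w []         = sym (+-identityʳ 0#)
  genFun-+ v w (ps ∷ pss) = begin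
    (v ps ℕ.+ w ps) · q ^ sum ps + genFun (λ ps → v ps ℕ.+ w ps) pss
      ≈⟨ +-cong (×-homo-+ _ (v ps) (w ps)) (genFun-+ v w pss) ⟩
    v ps · q ^ sum ps + w ps · q ^ sum ps + (genFun v pss + genFun w pss)
      ≈⟨ solve 4 (λ a b c d → a :+ b :+ (c :+ d) := a :+ c :+ (b :+ d)) refl _ _ _ _ ⟩
    genFun v (ps ∷ pss) + genFun w (ps ∷ pss) ∎

  genFun-cong : ∀ {v w} pss → (∀ {ps} → ps ∈ pss → v ps ≡ w ps) → genFun v pss ≈ genFun w pss
  genFun-cong []         v≡w = refl
  genFun-cong (ps ∷ pss) v≡w = +-cong (×-congˡ (v≡w (here ≡.refl))) (genFun-cong pss (v≡w ∘ there))

  genFun-mono : ∀ {v w} pss → (∀ {ps} → ps ∈ pss → v ps ≤ w ps) → genFun v pss ≼ genFun w pss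
  genFun-mono []         v≤w = ≼-refl
  genFun-mono {v} {w} (ps ∷ pss) v≤w = +-mono-≼
    ((w ps ℕ.∸ v ps) · q ^ sum ps , trans (sym (×-homo-+ _ (v ps) (w ps ℕ.∸ v ps)))
                                        (×-congˡ (ℕ.m+[n∸m]≡n (v≤w (here ≡.refl)))))
    (genFun-mono pss (v≤w ∘ there))

  genFun-suc-hooks : ∀ pss → genFun (suc ∘ hooks₂) pss ≈ genFun one pss + genFun hooks₂ pss
  genFun-suc-hooks = genFun-+ one hooks₂

  genFun-suc-hookPairs : ∀ pss → genFun (λ ps → suc (hooks₂ ps) C 2) pss ≈
                         genFun hooks₂ pss + genFun hookPairs pss
  genFun-suc-hookPairs pss = trans (genFun-cong pss (λ {ps} _ → [1+n]C2≡n+nC2 (hooks₂ ps)))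
                                   (genFun-+ hooks₂ hookPairs pss)

  genFun-2+-hookPairs : ∀ pss → genFun (λ ps → (2 ℕ.+ hooks₂ ps) C 2) pss ≈
    genFun one pss + genFun hooks₂ pss + (genFun hooks₂ pss + genFun hookPairs pss)
  genFun-2+-hookPairs pss = begin
    genFun (λ ps → (2 ℕ.+ hooks₂ ps) C 2) pss
      ≈⟨ genFun-cong pss (λ {ps} _ → [1+n]C2≡n+nC2 (suc (hooks₂ ps))) ⟩
    genFun (λ ps → suc (hooks₂ ps) ℕ.+ suc (hooks₂ ps) C 2) pss
      ≈⟨ genFun-+ (suc ∘ hooks₂) (λ ps → suc (hooks₂ ps) C 2) pss ⟩
    genFun (suc ∘ hooks₂) pss + genFun (λ ps → suc (hooks₂ ps) C 2) pss
      ≈⟨ +-cong (genFun-suc-hooks pss) (genFun-suc-hookPairs pss) ⟩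
    _ ∎

  -- Marked hooks in partitions into distinct parts

  distinctOne distinctHooks distinctHookPairs : ℕ → Carrier
  distinctOne       n = genFun one       (distinctLists n)
  distinctHooks     n = genFun hooks₂     (distinctLists n)
  distinctHookPairs n = genFun hookPairs (distinctLists n)

  genFun-distinct : ∀ w n → genFun w (distinctLists (suc n)) ≈
    genFun w (distinctLists n) + q ^ suc n * genFun (w ∘ (suc n ∷_)) (distinctLists n)
  genFun-distinct w n = trans (genFun-++ w (distinctLists n))
                              (+-congˡ (genFun-map-∷ w (suc n) (distinctLists n)))

  -- A new largest part 2 + n creates a hook unless 1 + n is a part.
  genFun-distinct-hooks : ∀ (f : ℕ → ℕ) n {u} →
    genFun (f ∘ suc ∘ hooks₂) (distinctLists n) ≈ u + genFun (f ∘ hooks₂) (distinctLists n) →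
    genFun (f ∘ hooks₂) (distinctLists (2 ℕ.+ n)) ≈
    (1# + q ^ (2 ℕ.+ n)) * genFun (f ∘ hooks₂) (distinctLists (1 ℕ.+ n)) + q ^ (2 ℕ.+ n) * u
  genFun-distinct-hooks f n {u} f-suc = begin
    genFun w (distinctLists (2 ℕ.+ n))
      ≈⟨ genFun-distinct w (suc n) ⟩
    e + y * genFun (w ∘ (2 ℕ.+ n ∷_)) (D ++ D′)
      ≈⟨ +-congˡ (*-congˡ (genFun-++ _ D)) ⟩
    e + y * (genFun (w ∘ (2 ℕ.+ n ∷_)) D + genFun (w ∘ (2 ℕ.+ n ∷_)) D′)
      ≈⟨ +-congˡ (*-congˡ (+-cong
           (genFun-cong D (λ ps∈ → ≡.cong f (hooks₂-gap (distinctLists-bounded n ps∈))))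
           (genFun-cong D′ consecutive))) ⟩
    e + y * (genFun (f ∘ suc ∘ hooks₂) D + genFun w D′)
      ≈⟨ +-congˡ (*-congˡ (+-congʳ f-suc)) ⟩
    e + y * (u + genFun w D + genFun w D′)
      ≈⟨ solve 5 (λ e y u a b → e :+ y :* (u :+ a :+ b) := e :+ y :* (a :+ b) :+ y :* u) refl e y u _ _ ⟩
    e + y * (genFun w D + genFun w D′) + y * u
      ≈⟨ +-congʳ (+-congˡ (*-congˡ (genFun-++ w D))) ⟨
    e + y * e + y * u
      ≈⟨ solve 3 (λ e y u → e :+ y :* e :+ y :* u := (con 1 :+ y) :* e :+ y :* u) refl e y u ⟩
    (1# + y) * e + y * u ∎
    where
    w  = f ∘ hooks₂
    y  = q ^ (2 ℕ.+ n)
    D  = distinctLists n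
    D′ = map (1 ℕ.+ n ∷_) D
    e  = genFun w (distinctLists (1 ℕ.+ n))

    consecutive : ∀ {ps} → ps ∈ D′ → w (2 ℕ.+ n ∷ ps) ≡ w ps
    consecutive ps∈ with ∈-map⁻ (1 ℕ.+ n ∷_) ps∈
    ... | _ , qs∈ , ≡.refl = ≡.cong f (hooks₂-consecutive (distinctLists-bounded n qs∈))

  distinctOne-closed : ∀ n → distinctOne n ≈ rising q 0 n
  distinctOne-closed zero    = solve 0 (con 1 :+ con 0 :+ con 0 := con 1) refl
  distinctOne-closed (suc n) = begin
    distinctOne (suc n)                         ≈⟨ genFun-distinct one n ⟩
    distinctOne n + q ^ suc n * distinctOne n   ≈⟨ solve 2 (λ d y → d :+ y :* d := d :* (con 1 :+ y)) refl _ _ ⟩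
    distinctOne n * (1# + q ^ suc n)            ≈⟨ *-congʳ (distinctOne-closed n) ⟩
    rising q 0 (suc n)                          ∎

  distinctHooks-suc : ∀ n → distinctHooks (2 ℕ.+ n) ≈
    (1# + q ^ (2 ℕ.+ n)) * distinctHooks (1 ℕ.+ n) + q ^ (2 ℕ.+ n) * distinctOne n
  distinctHooks-suc n =
    genFun-distinct-hooks (λ m → m) n (genFun-suc-hooks (distinctLists n))

  -- As C(h+1, 2) - C(h, 2) = h, a new hook contributes the series of single hooks. The three series
  -- thus form a triangular system, solved in turn below.
  distinctHookPairs-suc : ∀ n → distinctHookPairs (2 ℕ.+ n) ≈
    (1# + q ^ (2 ℕ.+ n)) * distinctHookPairs (1 ℕ.+ n) + q ^ (2 ℕ.+ n) * distinctHooks n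
  distinctHookPairs-suc n =
    genFun-distinct-hooks (_C 2) n (genFun-suc-hookPairs (distinctLists n))

  distinctHooks-1 : distinctHooks 1 ≈ 0#
  distinctHooks-1 = trans (+-identityˡ _) (+-identityˡ 0#)

  distinctHookPairs-3 : distinctHookPairs 3 ≈ 0#
  distinctHookPairs-3 = begin
    distinctHookPairs 3
      ≈⟨ distinctHookPairs-suc 1 ⟩
    a * distinctHookPairs 2 + b * distinctHooks 1
      ≈⟨ +-cong (*-congˡ (distinctHookPairs-suc 0)) (*-congˡ distinctHooks-1) ⟩
    a * (c * (0# + (0# + 0#)) + d * (0# + 0#)) + b * 0#
      ≈⟨ solve 4 (λ a b c d → a :* (c :* (con 0 :+ (con 0 :+ con 0)) :+ d :* (con 0 :+ con 0)) :+ b :* con 0 := con 0) refl a b c d ⟩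
    0# ∎
    where
    a = 1# + q ^ 3
    b = q ^ 3
    c = 1# + q ^ 2
    d = q ^ 2

  distinctHooks-closed : ∀ n → distinctHooks (2 ℕ.+ n) ≈ q * q * [ suc n ]⟨ q ⟩ * rising q 1 n
  distinctHooks-closed zero = begin
    distinctHooks 2
      ≈⟨ distinctHooks-suc 0 ⟩
    (1# + q ^ 2) * distinctHooks 1 + q ^ 2 * (1# + 0# + 0#)
      ≈⟨ +-congʳ (*-congˡ distinctHooks-1) ⟩
    (1# + q ^ 2) * 0# + q ^ 2 * (1# + 0# + 0#)
      ≈⟨ solve 1 (λ q → (con 1 :+ q :* (q :* con 1)) :* con 0 :+ q :* (q :* con 1) :* (con 1 :+ con 0 :+ con 0) := q :* q :* (con 1 :+ q :* con 0) :* con 1) refl q ⟩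
    q * q * [ 1 ]⟨ q ⟩ * 1# ∎
  distinctHooks-closed (suc n) = begin
    distinctHooks (3 ℕ.+ n)
      ≈⟨ distinctHooks-suc (suc n) ⟩
    (1# + q ^ (3 ℕ.+ n)) * distinctHooks (2 ℕ.+ n) + q ^ (3 ℕ.+ n) * distinctOne (suc n)
      ≈⟨ +-cong (*-congˡ (distinctHooks-closed n))
                (*-congˡ (trans (distinctOne-closed (suc n)) (rising-suc q 0 n))) ⟩
    (1# + q * (q * y)) * (q * q * b * r) + q * (q * y) * ((1# + q * 1#) * r)
      -- The summand y(1 + q) is split: y completes b to b′ by `[]-suc`, and q y completes q² y b to
      -- q y b′ by the definition of b′.
      ≈⟨ solve 4 (λ q y b r →
           (con 1 :+ q :* (q :* y)) :* (q :* q :* b :* r) :+ q :* (q :* y) :* ((con 1 :+ q :* con 1) :* r) :=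
           q :* q :* r :* (b :+ y :+ q :* y :* (con 1 :+ q :* b))) refl q y b r ⟩
    q * q * r * (b + y + q * y * b′)
      ≈⟨ *-congˡ (+-congʳ ([]-suc q (suc n))) ⟨
    q * q * r * (b′ + q * y * b′)
      ≈⟨ solve 4 (λ q y b r → q :* q :* r :* (b :+ q :* y :* b) := q :* q :* b :* (r :* (con 1 :+ q :* y))) refl q y b′ r ⟩
    q * q * b′ * rising q 1 (suc n) ∎
    where
    y  = q ^ suc n
    b  = [ suc n ]⟨ q ⟩
    b′ = [ 2 ℕ.+ n ]⟨ q ⟩
    r  = rising q 1 n

  -- The factor q⁶ is the partition 4 + 2, the smallest one into distinct parts with two hooks of
  -- length two.
  distinctHookPairs-closed : ∀ n →
    distinctHookPairs (4 ℕ.+ n) ≈ q ^ 6 * binom₂⟨ q ⟩ (2 ℕ.+ n) * rising q 2 n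
  distinctHookPairs-closed zero = begin
    distinctHookPairs 4
      ≈⟨ distinctHookPairs-suc 2 ⟩
    (1# + q ^ 4) * distinctHookPairs 3 + q ^ 4 * distinctHooks 2
      ≈⟨ +-cong (*-congˡ distinctHookPairs-3) (*-congˡ (distinctHooks-closed 0)) ⟩
    (1# + q ^ 4) * 0# + q ^ 4 * (q * q * [ 1 ]⟨ q ⟩ * 1#)
      ≈⟨ solve 1 (λ q → let q⁴ = q :* (q :* (q :* (q :* con 1))) in
           (con 1 :+ q⁴) :* con 0 :+ q⁴ :* (q :* q :* (con 1 :+ q :* con 0) :* con 1) :=
           q :* (q :* q⁴) :* (q :* q :* (q :* q :* con 0 :+ con 0) :+ (con 1 :+ q :* con 0)) :* con 1) refl q ⟩
    q ^ 6 * binom₂⟨ q ⟩ 2 * 1# ∎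
  distinctHookPairs-closed (suc n) = begin
    distinctHookPairs (5 ℕ.+ n)
      ≈⟨ distinctHookPairs-suc (3 ℕ.+ n) ⟩
    (1# + q ^ (5 ℕ.+ n)) * distinctHookPairs (4 ℕ.+ n) + q ^ (5 ℕ.+ n) * distinctHooks (3 ℕ.+ n)
      ≈⟨ +-cong (*-congˡ (distinctHookPairs-closed n))
                (*-congˡ (trans (distinctHooks-closed (suc n)) (*-congˡ (rising-suc q 1 n)))) ⟩
    (1# + q * (q * (q * (q * y)))) * (q ^ 6 * c * r) + q * (q * (q * (q * y))) * (q * q * b * ((1# + q ^ 2) * r))
      -- Both brackets equal c′: c + y b by `binom₂-suc`, and q² c + b by definition.
      ≈⟨ solve 5 (λ q y b c r → let q² = q :* (q :* con 1); q⁶ = q :* (q :* (q :* (q :* q²))) in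
           (con 1 :+ q :* (q :* (q :* (q :* y)))) :* (q⁶ :* c :* r)
             :+ q :* (q :* (q :* (q :* y))) :* (q :* q :* b :* ((con 1 :+ q²) :* r)) :=
           q⁶ :* r :* (c :+ y :* b :+ q :* (q :* y) :* (q :* q :* c :+ b))) refl q y b c r ⟩
    q ^ 6 * r * (c + y * b + q * (q * y) * c′)
      ≈⟨ *-congˡ (+-congʳ (binom₂-suc q (suc n))) ⟨
    q ^ 6 * r * (c′ + q * (q * y) * c′)
      ≈⟨ solve 5 (λ q⁶ q y c r → q⁶ :* r :* (c :+ q :* (q :* y) :* c) := q⁶ :* c :* (r :* (con 1 :+ q :* (q :* y)))) refl (q ^ 6) q y c′ r ⟩
    q ^ 6 * c′ * rising q 2 (suc n) ∎
    where
    y  = q ^ suc n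
    b  = [ 2 ℕ.+ n ]⟨ q ⟩
    c  = binom₂⟨ q ⟩ (2 ℕ.+ n)
    c′ = binom₂⟨ q ⟩ (3 ℕ.+ n)
    r  = rising q 2 n

  distinctHookPairs-≼ : ∀ k → ∃ λ N →
    distinctHookPairs (suc k ℕ.* 2) ≼ geomOdd N q (suc k) * (q ^ 6 * binom₂⟨ q * q ⟩ (suc k))
  -- Distinct parts at most 2 yield no pair of hooks.
  distinctHookPairs-≼ zero    = 0 , ≼-respˡ distinctHookPairs-2 0≼x
    where
    distinctHookPairs-2 : distinctHookPairs 2 ≈ 0#
    distinctHookPairs-2 = trans (distinctHookPairs-suc 0)
      (solve 2 (λ c d → c :* (con 0 :+ (con 0 :+ con 0)) :+ d :* (con 0 :+ con 0) := con 0) refl _ _)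
  -- Here L = 2(k + 2), and the product stops at L - 2 = 2(k + 1); Glaisher's inequality is taken
  -- there and one more odd part is then allowed.
  distinctHookPairs-≼ (suc k) = let N , glaisher = rising≼geomOdd (suc k) in N , (≼-respˡ
    (distinctHookPairs-closed (k ℕ.* 2)) (≼-trans
    (*-mono-≼ (*-monoˡ-≼ (binom₂-double-≼ q (suc k))) ≼-refl) (≼-respˡ
    (regroup k) (*-mono-≼ (≼-trans (glaisher q) (geomOdd-mono N q (ℕ.n≤1+n (suc k)))) ≼-refl))))
    where
    -- The factors (1 + q)(1 + q²) paid for the passage to base q² are exactly those that
    -- `rising q 2` lacks.
    regroup : ∀ k → let e = binom₂⟨ q * q ⟩ (2 ℕ.+ k); r = rising q 2 (k ℕ.* 2) in
      q ^ 6 * ((1# + q) * (1# + q * q) * e) * r ≈ rising q 0 (suc k ℕ.* 2) * (q ^ 6 * e)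
    regroup k = begin
      q ^ 6 * ((1# + q) * (1# + q * q) * e) * r
        ≈⟨ solve 4 (λ q⁶ q e r → q⁶ :* ((con 1 :+ q) :* (con 1 :+ q :* q) :* e) :* r :=
             (con 1 :+ q :* con 1) :* ((con 1 :+ q :* (q :* con 1)) :* r) :* (q⁶ :* e)) refl (q ^ 6) q e r ⟩
      (1# + q ^ 1) * ((1# + q ^ 2) * r) * (q ^ 6 * e)
        ≈⟨ *-congʳ (*-congˡ (rising-suc q 1 (k ℕ.* 2))) ⟨
      (1# + q ^ 1) * rising q 1 (suc (k ℕ.* 2)) * (q ^ 6 * e)
        ≈⟨ *-congʳ (rising-suc q 0 (suc (k ℕ.* 2))) ⟨
      rising q 0 (suc k ℕ.* 2) * (q ^ 6 * e) ∎
      where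
      e = binom₂⟨ q * q ⟩ (2 ℕ.+ k)
      r = rising q 2 (k ℕ.* 2)

  -- Marked hooks in partitions into odd parts

  genFun-withCopies : ∀ {v} w p N pss →
    (∀ {ps} → ps ∈ pss → ∀ m → v ps ≤ w (replicate m p ++ ps)) →
    geom N (q ^ p) * genFun v pss ≼ genFun w (withCopies p N pss)
  genFun-withCopies w p zero    pss v≤w =
    ≼-respˡ (*-identityˡ _) (genFun-mono pss (λ ps∈ → v≤w ps∈ 0))
  genFun-withCopies {v} w p (suc N) pss v≤w = ≼-respˡ
    (solve 3 (λ y g f → (con 1 :+ y :* g) :* f := f :+ y :* (g :* f)) refl _ _ _) (≼-respʳ
    (+-mono-≼ (genFun-mono pss (λ ps∈ → v≤w ps∈ 0))
              -- The copy of p just added is absorbed into the weight. Since v bounds the weight for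
              -- every multiplicity, the powers of qᵖ factor out.
              (*-monoˡ-≼ (genFun-withCopies (w ∘ (p ∷_)) p N pss (λ ps∈ m → v≤w ps∈ (suc m)))))
    (sym (trans (genFun-++ w pss) (+-congˡ (genFun-map-∷ w p (withCopies p N pss))))))

  -- Multiplicity zero is kept apart because only an actual copy of p brings a hook; v may then be
  -- larger than w on the original lists.
  genFun-withCopies-suc : ∀ {v} w p N pss →
    (∀ {ps} → ps ∈ pss → ∀ m → v ps ≤ w (p ∷ replicate m p ++ ps)) →
    genFun w pss + q ^ p * (geom N (q ^ p) * genFun v pss) ≼ genFun w (withCopies p (suc N) pss)
  genFun-withCopies-suc w p N pss v≤w = ≼-respʳ
    (+-mono-≼ ≼-refl (*-monoˡ-≼ (genFun-withCopies (w ∘ (p ∷_)) p N pss v≤w)))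
    (sym (trans (genFun-++ w pss) (+-congˡ (genFun-map-∷ w p (withCopies p N pss)))))

  -- The slack of two copies is for the marked hooks, which can both come from the same part. The
  -- same lists serve all three weights.
  genFun-oddLists-one : ∀ N k → geomOdd N q k ≼ genFun one (oddLists (2 ℕ.+ N) k)
  genFun-oddLists-one N zero    = ≈⇒≼ (solve 0 (con 1 := con 1 :+ con 0 :+ con 0) refl)
  genFun-oddLists-one N (suc k) = ≼-trans
    (≼-respˡ (*-comm _ _) (*-mono-≼
      (≼-trans (geom-mono N _) (geom-mono (suc N) _)) (genFun-oddLists-one N k)))
    (genFun-withCopies one (suc (k ℕ.* 2)) (2 ℕ.+ N) (oddLists (2 ℕ.+ N) k) (λ _ _ → ℕ.≤-refl))

  oddLists-bounded : ∀ N k {ps} → ps ∈ oddLists N (suc k) → All (_≤ suc (k ℕ.* 2)) ps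
  oddLists-bounded N k ps∈ = All.map (ℕ.≤-pred ∘ proj₂) (proj₂ (oddLists-sound N (suc k) ps∈))

  q-oddPower : ∀ k → q ^ (3 ℕ.+ k ℕ.* 2) ≈ q ^ 3 * (q * q) ^ k
  q-oddPower k = trans (^-homo-* q 3 (k ℕ.* 2)) (*-congˡ (sym (square-^ q k)))

  genFun-oddLists-hooks : ∀ N k →
    geomOdd N q (suc k) * (q ^ 3 * [ k ]⟨ q * q ⟩) ≼ genFun hooks₂ (oddLists (2 ℕ.+ N) (suc k))
  genFun-oddLists-hooks N zero    = ≼-respˡ (trans (*-congˡ (zeroʳ _)) (zeroʳ _)) 0≼x
  genFun-oddLists-hooks N (suc k) = ≼-respˡ (begin
      P * g * (q ^ 3 * [ suc k ]⟨ q * q ⟩)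
        ≈⟨ *-congˡ (trans (*-congˡ ([]-suc (q * q) k)) (distribˡ _ _ _)) ⟩
      P * g * (S + q ^ 3 * (q * q) ^ k)
        ≈⟨ *-congˡ (+-congˡ (q-oddPower k)) ⟨
      P * g * (S + y)
        -- The marked hook comes either from a smaller part or from the new largest part p.
        ≈⟨ solve 4 (λ P g S y → P :* g :* (S :+ y) := g :* (P :* S) :+ y :* (g :* P)) refl P g S y ⟩
      g * (P * S) + y * (g * P) ∎)
    (≼-trans (+-mono-≼ (*-mono-≼ (≼-trans (geom-mono N y) (geom-mono (suc N) y)) (genFun-oddLists-hooks N k))
                       (*-monoˡ-≼ (*-mono-≼ (geom-mono N y) (genFun-oddLists-one N (suc k)))))
    (≼-respˡ (begin
      (1# + y * g′) * U₁ + y * (g′ * U₀)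
        ≈⟨ solve 4 (λ y g U₀ U₁ → (con 1 :+ y :* g) :* U₁ :+ y :* (g :* U₀) := U₁ :+ y :* (g :* (U₀ :+ U₁))) refl y g′ U₀ U₁ ⟩
      U₁ + y * (g′ * (U₀ + U₁))
        ≈⟨ +-congˡ (*-congˡ (*-congˡ (genFun-suc-hooks O))) ⟨
      U₁ + y * (g′ * genFun (suc ∘ hooks₂) O) ∎)
    (genFun-withCopies-suc hooks₂ p (suc N) O
      (λ ps∈ → hooks₂-replicate-≥1 (oddLists-bounded (2 ℕ.+ N) k ps∈)))))
    where
    p  = 3 ℕ.+ k ℕ.* 2
    y  = q ^ p
    g  = geom N y
    g′ = geom (suc N) y
    P  = geomOdd N q (suc k)
    S  = q ^ 3 * [ k ]⟨ q * q ⟩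
    O  = oddLists (2 ℕ.+ N) (suc k)
    U₀ = genFun one O
    U₁ = genFun hooks₂ O

  genFun-oddLists-hookPairs : ∀ N k →
    geomOdd N q (suc k) * (q ^ 6 * binom₂⟨ q * q ⟩ (suc k)) ≼
    genFun hookPairs (oddLists (2 ℕ.+ N) (suc k))
  genFun-oddLists-hookPairs N zero    = ≼-respˡ
    (trans (*-congˡ (trans (*-congˡ (trans (+-identityʳ _) (zeroʳ _))) (zeroʳ _))) (zeroʳ _)) 0≼x
  genFun-oddLists-hookPairs N (suc k) = ≼-respˡ (begin
      P * g * (q ^ 6 * binom₂⟨ q * q ⟩ (2 ℕ.+ k))
        ≈⟨ *-congˡ H-suc ⟩
      P * g * (H + y * (S + y))
        -- The new part p provides none, one or both of the marked hooks.
        ≈⟨ solve 5 (λ P g H S y → P :* g :* (H :+ y :* (S :+ y)) :=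
             g :* (P :* H) :+ y :* (g :* (P :* S)) :+ y :* (y :* (g :* P))) refl P g H S y ⟩
      g * (P * H) + y * (g * (P * S)) + y * (y * (g * P)) ∎)
    (≼-trans (+-mono-≼ (+-mono-≼
        (*-mono-≼ (≼-trans (geom-mono N y) (geom-mono (suc N) y)) (genFun-oddLists-hookPairs N k))
        (*-monoˡ-≼ (*-mono-≼ (geom-mono N y) (genFun-oddLists-hooks N k))))
        (*-monoˡ-≼ (*-monoˡ-≼ (*-monoˡ-≼ (genFun-oddLists-one N (suc k))))))
    -- With at least two copies of p the weight is C(h+2, 2) = 1 + 2h + C(h, 2), while h₂ accounts
    -- for only one of the two terms h. The witness is this surplus.
    (≼-trans (y * (y * (g * U₁)) , (begin
      (1# + y * (1# + y * g)) * U₂ + y * ((1# + y * g) * U₁) + y * (y * (g * U₀)) + y * (y * (g * U₁))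
        ≈⟨ solve 5 (λ y g U₀ U₁ U₂ →
             (con 1 :+ y :* (con 1 :+ y :* g)) :* U₂ :+ y :* ((con 1 :+ y :* g) :* U₁) :+ y :* (y :* (g :* U₀)) :+ y :* (y :* (g :* U₁)) :=
             U₂ :+ y :* (U₁ :+ U₂ :+ y :* (g :* (U₀ :+ U₁ :+ (U₁ :+ U₂))))) refl y g U₀ U₁ U₂ ⟩
      U₂ + y * (U₁ + U₂ + y * (g * (U₀ + U₁ + (U₁ + U₂))))
        ≈⟨ +-congˡ (*-congˡ (+-cong
             (trans (genFun-cong O (λ ps∈ → ≡.cong (_C 2) (hooks₂-gap (bounded ps∈)))) (genFun-suc-hookPairs O))
             (*-congˡ (*-congˡ (genFun-2+-hookPairs O))))) ⟨
      U₂ + y * (genFun (hookPairs ∘ (p ∷_)) O + y * (g * genFun (λ ps → (2 ℕ.+ hooks₂ ps) C 2) O)) ∎))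
    (≼-respʳ
      (+-mono-≼ ≼-refl (*-monoˡ-≼ (genFun-withCopies-suc (hookPairs ∘ (p ∷_)) p N O
        (λ ps∈ m → C2-mono (hooks₂-replicate-≥2 (bounded ps∈) m)))))
      (sym (trans (genFun-++ hookPairs O)
                  (+-congˡ (genFun-map-∷ hookPairs p (withCopies p (suc N) O))))))))
    where
    p  = 3 ℕ.+ k ℕ.* 2
    y  = q ^ p
    g  = geom N y
    P  = geomOdd N q (suc k)
    S  = q ^ 3 * [ k ]⟨ q * q ⟩
    H  = q ^ 6 * binom₂⟨ q * q ⟩ (suc k)
    O  = oddLists (2 ℕ.+ N) (suc k)
    U₀ = genFun one O
    U₁ = genFun hooks₂ O
    U₂ = genFun hookPairs O

    bounded : ∀ {ps} → ps ∈ O → All (_≤ suc (k ℕ.* 2)) ps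
    bounded = oddLists-bounded (2 ℕ.+ N) k

    -- The recurrence of h₂ when the variable y is adjoined, where S and H are h₁ and h₂ of q³, q⁵,
    -- ..., q²ᵏ⁺¹.
    H-suc : q ^ 6 * binom₂⟨ q * q ⟩ (2 ℕ.+ k) ≈ H + y * (S + y)
    H-suc = begin
      q ^ 6 * binom₂⟨ q * q ⟩ (2 ℕ.+ k)
        ≈⟨ *-congˡ (trans (binom₂-suc (q * q) k) (+-congˡ (*-congˡ ([]-suc (q * q) k)))) ⟩
      q ^ 6 * (c + z * (b + z))
        ≈⟨ solve 4 (λ q c z b → let q³ = q :* (q :* (q :* con 1)); q⁶ = q :* (q :* (q :* q³)) in
             q⁶ :* (c :+ z :* (b :+ z)) := q⁶ :* c :+ q³ :* z :* (q³ :* b :+ q³ :* z)) refl q c z b ⟩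
      H + q ^ 3 * z * (S + q ^ 3 * z)
        ≈⟨ +-congˡ (*-cong (q-oddPower k) (+-congˡ (q-oddPower k))) ⟨
      H + y * (S + y) ∎
      where
      b = [ k ]⟨ q * q ⟩
      c = binom₂⟨ q * q ⟩ (suc k)
      z = (q * q) ^ k

  hookPairs-≼ : ∀ k → ∃ λ N →
    genFun hookPairs (distinctLists (suc k ℕ.* 2)) ≼ genFun hookPairs (oddLists N (suc k))
  hookPairs-≼ k = let N , distinct≼ = distinctHookPairs-≼ k in
    2 ℕ.+ N , ≼-trans distinct≼ (genFun-oddLists-hookPairs N k)

-- Formal power series

open import Data.Nat.Base using (_*_)

module PowerSeries where

  open +-*-Solver using (solve; _:+_; _:*_; _:=_)
  open ≡.≡-Reasoning

  Series : Set
  Series = ℕ → ℕ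

  infixl 6 _⊕_
  infixl 7 _⊛_

  _⊕_ : Series → Series → Series
  (f ⊕ g) n = f n ℕ.+ g n

  -- The Cauchy product, by the decomposition of f into f(0) and q times its shift `f ∘ suc`.
  _⊛_ : Series → Series → Series
  (f ⊛ g) zero    = f 0 * g 0
  (f ⊛ g) (suc n) = f 0 * g (suc n) ℕ.+ (f ∘ suc ⊛ g) n

  𝟘 𝟙 : Series
  𝟘 _       = 0
  𝟙 zero    = 1
  𝟙 (suc _) = 0

  ⊛-cong : ∀ {f f′ g g′} → f ≗ f′ → g ≗ g′ → f ⊛ g ≗ f′ ⊛ g′
  ⊛-cong f≗ g≗ zero    = ≡.cong₂ _*_ (f≗ 0) (g≗ 0)
  ⊛-cong f≗ g≗ (suc n) =
    ≡.cong₂ ℕ._+_ (≡.cong₂ _*_ (f≗ 0) (g≗ (suc n))) (⊛-cong (f≗ ∘ suc) g≗ n)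

  ⊛-zeroˡ : ∀ g → 𝟘 ⊛ g ≗ 𝟘
  ⊛-zeroˡ g zero    = ≡.refl
  ⊛-zeroˡ g (suc n) = ⊛-zeroˡ g n

  ⊛-identityˡ : ∀ g → 𝟙 ⊛ g ≗ g
  ⊛-identityˡ g zero    = ℕ.+-identityʳ (g 0)
  ⊛-identityˡ g (suc n) = begin
    (g (suc n) ℕ.+ 0) ℕ.+ (𝟘 ⊛ g) n   ≡⟨ ≡.cong₂ ℕ._+_ (ℕ.+-identityʳ (g (suc n))) (⊛-zeroˡ g n) ⟩
    g (suc n) ℕ.+ 0                   ≡⟨ ℕ.+-identityʳ (g (suc n)) ⟩
    g (suc n)                         ∎

  -- The product unfolds only its left factor. Unfolding both factors in turn lowers the degree by
  -- two, hence the two base cases.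
  ⊛-comm : ∀ f g → f ⊛ g ≗ g ⊛ f
  ⊛-comm f g zero          = ℕ.*-comm (f 0) (g 0)
  ⊛-comm f g (suc zero)    =
    solve 4 (λ a b c d → a :* d :+ b :* c := c :* b :+ d :* a) ≡.refl (f 0) (f 1) (g 0) (g 1)
  ⊛-comm f g (suc (suc n)) = begin
    f 0 * g (2 ℕ.+ n) ℕ.+ (f ∘ suc ⊛ g) (suc n)
      ≡⟨ ≡.cong (f 0 * g (2 ℕ.+ n) ℕ.+_) (⊛-comm (f ∘ suc) g (suc n)) ⟩
    f 0 * g (2 ℕ.+ n) ℕ.+ (g 0 * f (2 ℕ.+ n) ℕ.+ (g ∘ suc ⊛ f ∘ suc) n)
      ≡⟨ ≡.cong (λ z → f 0 * g (2 ℕ.+ n) ℕ.+ (g 0 * f (2 ℕ.+ n) ℕ.+ z)) (⊛-comm (g ∘ suc) (f ∘ suc) n) ⟩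
    f 0 * g (2 ℕ.+ n) ℕ.+ (g 0 * f (2 ℕ.+ n) ℕ.+ (f ∘ suc ⊛ g ∘ suc) n)
      ≡⟨ solve 3 (λ a b c → a :+ (b :+ c) := b :+ (a :+ c)) ≡.refl (f 0 * g (2 ℕ.+ n)) (g 0 * f (2 ℕ.+ n)) _ ⟩
    g 0 * f (2 ℕ.+ n) ℕ.+ (f ⊛ g ∘ suc) (suc n)
      ≡⟨ ≡.cong (g 0 * f (2 ℕ.+ n) ℕ.+_) (⊛-comm f (g ∘ suc) (suc n)) ⟩
    g 0 * f (2 ℕ.+ n) ℕ.+ (g ∘ suc ⊛ f) (suc n) ∎

  ⊛-distribʳ-⊕ : ∀ h f g → (f ⊕ g) ⊛ h ≗ f ⊛ h ⊕ g ⊛ h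
  ⊛-distribʳ-⊕ h f g zero    = ℕ.*-distribʳ-+ (h 0) (f 0) (g 0)
  ⊛-distribʳ-⊕ h f g (suc n) = ≡.trans
    (≡.cong ((f 0 ℕ.+ g 0) * h (suc n) ℕ.+_) (⊛-distribʳ-⊕ h (f ∘ suc) (g ∘ suc) n))
    (solve 5 (λ a b c x y → (a :+ b) :* c :+ (x :+ y) := a :* c :+ x :+ (b :* c :+ y)) ≡.refl
      (f 0) (g 0) (h (suc n)) _ _)

  ⊛-scaleˡ : ∀ c f g n → ((λ k → c * f k) ⊛ g) n ≡ c * (f ⊛ g) n
  ⊛-scaleˡ c f g zero    = ℕ.*-assoc c (f 0) (g 0)
  ⊛-scaleˡ c f g (suc n) = ≡.trans
    (≡.cong (c * f 0 * g (suc n) ℕ.+_) (⊛-scaleˡ c (f ∘ suc) g n))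
    (solve 4 (λ c a b x → c :* a :* b :+ c :* x := c :* (a :* b :+ x)) ≡.refl c (f 0) (g (suc n)) _)

  ⊛-assoc : ∀ f g h → (f ⊛ g) ⊛ h ≗ f ⊛ (g ⊛ h)
  ⊛-assoc f g h zero    = ℕ.*-assoc (f 0) (g 0) (h 0)
  ⊛-assoc f g h (suc n) = begin
    f 0 * g 0 * h (suc n) ℕ.+ (((λ k → f 0 * g (suc k)) ⊕ (f ∘ suc ⊛ g)) ⊛ h) n
      ≡⟨ ≡.cong (f 0 * g 0 * h (suc n) ℕ.+_) (⊛-distribʳ-⊕ h (λ k → f 0 * g (suc k)) (f ∘ suc ⊛ g) n) ⟩
    f 0 * g 0 * h (suc n) ℕ.+ (((λ k → f 0 * g (suc k)) ⊛ h) n ℕ.+ ((f ∘ suc ⊛ g) ⊛ h) n)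
      ≡⟨ ≡.cong₂ (λ x y → f 0 * g 0 * h (suc n) ℕ.+ (x ℕ.+ y))
           (⊛-scaleˡ (f 0) (g ∘ suc) h n) (⊛-assoc (f ∘ suc) g h n) ⟩
    f 0 * g 0 * h (suc n) ℕ.+ (f 0 * (g ∘ suc ⊛ h) n ℕ.+ (f ∘ suc ⊛ (g ⊛ h)) n)
      ≡⟨ solve 5 (λ a b c x y → a :* b :* c :+ (a :* x :+ y) := a :* (b :* c :+ x) :+ y) ≡.refl
           (f 0) (g 0) (h (suc n)) _ _ ⟩
    f 0 * (g ⊛ h) (suc n) ℕ.+ (f ∘ suc ⊛ (g ⊛ h)) n ∎

  powerSeries : CommutativeSemiring 0ℓ 0ℓ
  powerSeries = record
    { Carrier = Series
    ; _≈_     = _≗_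
    ; _+_     = _⊕_
    ; _*_     = _⊛_
    ; 0#      = 𝟘
    ; 1#      = 𝟙
    ; isCommutativeSemiring = isCommutativeSemiringˡ record
      { +-isCommutativeMonoid = record
        { isMonoid = record
          { isSemigroup = record
            { isMagma = record
              { isEquivalence = isEquivalence
              ; ∙-cong        = λ f≗ g≗ n → ≡.cong₂ ℕ._+_ (f≗ n) (g≗ n)
              }
            ; assoc = λ f g h n → ℕ.+-assoc (f n) (g n) (h n)
            }
          ; identity = (λ f n → ≡.refl) , (λ f n → ℕ.+-identityʳ (f n))
          }
        ; comm = λ f g n → ℕ.+-comm (f n) (g n)
        }
      ; *-isCommutativeMonoid = record
        { isMonoid = record
          { isSemigroup = record
            { isMagma = record
              { isEquivalence = isEquivalence
              ; ∙-cong        = ⊛-cong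
              }
            ; assoc = ⊛-assoc
            }
          ; identity = ⊛-identityˡ , λ f n → ≡.trans (⊛-comm f 𝟙 n) (⊛-identityˡ f n)
          }
        ; comm = ⊛-comm
        }
      ; distribʳ = ⊛-distribʳ-⊕
      ; zeroˡ    = ⊛-zeroˡ
      }
    }
    where
    open Setoid (ℕ ≡.→-setoid ℕ) using (isEquivalence)

  q : Series
  q zero    = 0
  q (suc n) = 𝟙 n

  open CommutativeSemiring powerSeries using (semiring)
  open import Algebra.Properties.Semiring.Exp semiring using (_^_)
  open import Algebra.Properties.Semiring.Mult semiring using () renaming (_×_ to _·_)
  open NaturalOrder powerSeries using (_≼_)
  open GeneratingFunctions powerSeries q

  q-shift : ∀ f n → (q ⊛ f) (suc n) ≡ f n
  q-shift f n = ⊛-identityˡ f n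

  q^n-coeff : ∀ n → (q ^ n) n ≡ 1
  q^n-coeff zero    = ≡.refl
  q^n-coeff (suc n) = ≡.trans (q-shift (q ^ n) n) (q^n-coeff n)

  q^m-coeff-≢ : ∀ m n → m ≢ n → (q ^ m) n ≡ 0
  q^m-coeff-≢ zero    zero    m≢n = contradiction ≡.refl m≢n
  q^m-coeff-≢ zero    (suc n) m≢n = ≡.refl
  q^m-coeff-≢ (suc m) zero    m≢n = ≡.refl
  q^m-coeff-≢ (suc m) (suc n) m≢n =
    ≡.trans (q-shift (q ^ m) n) (q^m-coeff-≢ m n (m≢n ∘ ≡.cong suc))

  ·-coeff : ∀ m f n → (m · f) n ≡ m * f n
  ·-coeff zero    f n = ≡.refl
  ·-coeff (suc m) f n = ≡.cong (f n ℕ.+_) (·-coeff m f n)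

  genFun-coeff : ∀ w pss n → genFun w pss n ≡ sum (map w (filter (λ ps → sum ps ℕ.≟ n) pss))
  genFun-coeff w []         n = ≡.refl
  genFun-coeff w (ps ∷ pss) n with sum ps ℕ.≟ n
  ... | yes ≡.refl = begin
    (w ps · q ^ n) n ℕ.+ genFun w pss n
      ≡⟨ ≡.cong₂ ℕ._+_ (·-coeff (w ps) (q ^ n) n) (genFun-coeff w pss n) ⟩
    w ps * (q ^ n) n ℕ.+ rest
      ≡⟨ ≡.cong (λ c → w ps * c ℕ.+ rest) (q^n-coeff n) ⟩
    w ps * 1 ℕ.+ rest
      ≡⟨ ≡.cong (ℕ._+ rest) (ℕ.*-identityʳ (w ps)) ⟩
    w ps ℕ.+ rest
      ≡⟨ ≡.cong (sum ∘ map w) (List.filter-accept (λ qs → sum qs ℕ.≟ n) {x = ps} {xs = pss} ≡.refl) ⟨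
    _ ∎
    where rest = sum (map w (filter (λ qs → sum qs ℕ.≟ n) pss))
  ... | no sum≢n = begin
    (w ps · q ^ sum ps) n ℕ.+ genFun w pss n
      ≡⟨ ≡.cong₂ ℕ._+_ (·-coeff (w ps) (q ^ sum ps) n) (genFun-coeff w pss n) ⟩
    w ps * (q ^ sum ps) n ℕ.+ rest
      ≡⟨ ≡.cong (λ c → w ps * c ℕ.+ rest) (q^m-coeff-≢ (sum ps) n sum≢n) ⟩
    w ps * 0 ℕ.+ rest
      ≡⟨ ≡.cong (ℕ._+ rest) (ℕ.*-zeroʳ (w ps)) ⟩
    rest
      ≡⟨ ≡.cong (sum ∘ map w) (List.filter-reject (λ qs → sum qs ℕ.≟ n) {x = ps} {xs = pss} sum≢n) ⟨
    _ ∎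
    where rest = sum (map w (filter (λ qs → sum qs ℕ.≟ n) pss))

  ≼⇒≤ : ∀ {f g} → f ≼ g → ∀ n → f n ≤ g n
  ≼⇒≤ (h , f⊕h≗g) n = ℕ.≤-trans (ℕ.m≤m+n _ (h n)) (ℕ.≤-reflexive (f⊕h≗g n))

  sum-hookPairs-≤ : ∀ k n → ∃ λ N →
    sum (map hookPairs (filter (λ ps → sum ps ℕ.≟ n) (distinctLists (suc k * 2)))) ≤
    sum (map hookPairs (filter (λ ps → sum ps ℕ.≟ n) (oddLists N (suc k))))
  sum-hookPairs-≤ k n = let N , distinct≼odd = hookPairs-≼ k in N , (≡.subst₂ _≤_
    (genFun-coeff hookPairs (distinctLists (suc k * 2)) n)
    (genFun-coeff hookPairs (oddLists N (suc k)) n)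
    (≼⇒≤ distinct≼odd n))

-- Each element of `xs` is cut out of `ys` in turn; uniqueness of `xs` keeps the later ones in what
-- remains. This compares enumerations that list partitions in different orders.
sum-map-mono-⊆ : ∀ {A : Set} (w : A → ℕ) {xs ys} → Unique xs → (∀ {x} → x ∈ xs → x ∈ ys) →
                 sum (map w xs) ≤ sum (map w ys)
sum-map-mono-⊆ w {[]}     {ys} []           xs⊆ys = z≤n
sum-map-mono-⊆ w {x ∷ xs} {ys} (x∉xs ∷ xs!) xs⊆ys with ∈-∃++ (xs⊆ys (here ≡.refl))
... | as , bs , ≡.refl = begin
  w x ℕ.+ sum (map w xs)         ≤⟨ ℕ.+-monoʳ-≤ (w x) (sum-map-mono-⊆ w xs! xs⊆as++bs) ⟩
  w x ℕ.+ sum (map w (as ++ bs)) ≡⟨ sum-↭ (map⁺ w (shift x as bs)) ⟨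
  sum (map w (as ++ [ x ] ++ bs)) ∎
  where
  open ℕ.≤-Reasoning
  xs⊆as++bs : ∀ {y} → y ∈ xs → y ∈ as ++ bs
  xs⊆as++bs y∈xs with ∈-++⁻ as (xs⊆ys (there y∈xs))
  ... | inj₁ y∈as             = ∈-++⁺ˡ y∈as
  ... | inj₂ (here ≡.refl)    = contradiction ≡.refl (All.lookup x∉xs y∈xs)
  ... | inj₂ (there y∈bs)     = ∈-++⁺ʳ as y∈bs

-- Summing over the number of hooks

∑-suc : ∀ N f → ∑[m≤ suc N ] f ≡ ∑[m≤ N ] f ℕ.+ f (suc N)
∑-suc N f = begin
  sum (map f (upTo (2 ℕ.+ N)))                       ≡⟨ ≡.cong (sum ∘ map f) (List.upTo-∷ʳ (suc N)) ⟨
  sum (map f (upTo (suc N) ++ [ suc N ]))            ≡⟨ ≡.cong sum (List.map-++ f (upTo (suc N)) [ suc N ]) ⟩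
  sum (map f (upTo (suc N)) ++ [ f (suc N) ])        ≡⟨ sum-++ (map f (upTo (suc N))) [ f (suc N) ] ⟩
  ∑[m≤ N ] f ℕ.+ (f (suc N) ℕ.+ 0)                   ≡⟨ ≡.cong (∑[m≤ N ] f ℕ.+_) (ℕ.+-identityʳ (f (suc N))) ⟩
  ∑[m≤ N ] f ℕ.+ f (suc N)                           ∎
  where open ≡.≡-Reasoning

∑-cong : ∀ N {f g} → f ≗ g → ∑[m≤ N ] f ≡ ∑[m≤ N ] g
∑-cong N f≗g = ≡.cong sum (List.map-cong f≗g (upTo (suc N)))

∑-+ : ∀ N f g → ∑[m≤ N ] (λ m → f m ℕ.+ g m) ≡ ∑[m≤ N ] f ℕ.+ ∑[m≤ N ] g
∑-+ N f g = go (upTo (suc N))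
  where
  open +-*-Solver using (solve; _:+_; _:=_)
  go : ∀ ms → sum (map (λ m → f m ℕ.+ g m) ms) ≡ sum (map f ms) ℕ.+ sum (map g ms)
  go []       = ≡.refl
  go (m ∷ ms) = ≡.trans (≡.cong (f m ℕ.+ g m ℕ.+_) (go ms))
    (solve 4 (λ a b c d → a :+ b :+ (c :+ d) := a :+ c :+ (b :+ d)) ≡.refl (f m) (g m) _ _)

∑-zero : ∀ N {f} → (∀ m → f m ≡ 0) → ∑[m≤ N ] f ≡ 0
∑-zero N {f} f≡0 = go (upTo (suc N))
  where
  go : ∀ ms → sum (map f ms) ≡ 0
  go []       = ≡.refl
  go (m ∷ ms) = ≡.cong₂ ℕ._+_ (f≡0 m) (go ms)

-- Kronecker's delta, as a filtered count so that `filter-accept` and `filter-reject` evaluate it.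
δ : ℕ → ℕ → ℕ
δ k m = length (filter (k ℕ.≟_) [ m ])

δ-≡ : ∀ {k m} → k ≡ m → δ k m ≡ 1
δ-≡ {k} k≡m = ≡.cong length (List.filter-accept (k ℕ.≟_) {xs = []} k≡m)

δ-≢ : ∀ {k m} → k ≢ m → δ k m ≡ 0
δ-≢ {k} k≢m = ≡.cong length (List.filter-reject (k ℕ.≟_) {xs = []} k≢m)

∑-δ-> : ∀ (w : ℕ → ℕ) k N → N < k → ∑[m≤ N ] (λ m → w m * δ k m) ≡ 0
∑-δ-> w (suc k) zero    N<k = ≡.trans (ℕ.+-identityʳ _) (ℕ.*-zeroʳ (w 0))
∑-δ-> w k       (suc N) N<k = begin
  ∑[m≤ suc N ] (λ m → w m * δ k m)
    ≡⟨ ∑-suc N (λ m → w m * δ k m) ⟩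
  ∑[m≤ N ] (λ m → w m * δ k m) ℕ.+ w (suc N) * δ k (suc N)
    ≡⟨ ≡.cong₂ ℕ._+_ (∑-δ-> w k N (ℕ.<-trans (ℕ.n<1+n N) N<k)) (≡.cong (w (suc N) *_) (δ-≢ (ℕ.>⇒≢ N<k))) ⟩
  w (suc N) * 0
    ≡⟨ ℕ.*-zeroʳ (w (suc N)) ⟩
  0 ∎
  where open ≡.≡-Reasoning

∑-δ : ∀ (w : ℕ → ℕ) {k} N → k ≤ N → ∑[m≤ N ] (λ m → w m * δ k m) ≡ w k
∑-δ w zero    z≤n = ≡.trans (ℕ.+-identityʳ _) (ℕ.*-identityʳ (w 0))
∑-δ w {k} (suc N) k≤1+N with ℕ.m≤n⇒m<n∨m≡n k≤1+N
... | inj₁ k<1+N = begin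
  ∑[m≤ suc N ] (λ m → w m * δ k m)
    ≡⟨ ∑-suc N (λ m → w m * δ k m) ⟩
  ∑[m≤ N ] (λ m → w m * δ k m) ℕ.+ w (suc N) * δ k (suc N)
    ≡⟨ ≡.cong₂ ℕ._+_ (∑-δ w N (ℕ.≤-pred k<1+N)) (≡.cong (w (suc N) *_) (δ-≢ (ℕ.<⇒≢ k<1+N))) ⟩
  w k ℕ.+ w (suc N) * 0
    ≡⟨ ≡.trans (≡.cong (w k ℕ.+_) (ℕ.*-zeroʳ (w (suc N)))) (ℕ.+-identityʳ (w k)) ⟩
  w k ∎
  where open ≡.≡-Reasoning
... | inj₂ ≡.refl = begin
  ∑[m≤ suc N ] (λ m → w m * δ k m)
    ≡⟨ ∑-suc N (λ m → w m * δ k m) ⟩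
  ∑[m≤ N ] (λ m → w m * δ k m) ℕ.+ w k * δ k k
    ≡⟨ ≡.cong₂ ℕ._+_ (∑-δ-> w k N ℕ.≤-refl) (≡.cong (w k *_) (δ-≡ {k} ≡.refl)) ⟩
  w k * 1
    ≡⟨ ℕ.*-identityʳ (w k) ⟩
  w k ∎
  where open ≡.≡-Reasoning

-- Double counting: x is counted once, at m = h x, which the bound N keeps in range. The predicate
-- has the form to which those in `a₂` and `b₂` unfold.
∑-filter : ∀ {A : Set} {P : A → Set} (P? : Decidable P) (h : A → ℕ) (w : ℕ → ℕ) N {xs} →
  All (λ x → h x ≤ N) xs →
  ∑[m≤ N ] (λ m → w m * length (filter (λ x → P? x ×-dec (h x ℕ.≟ m)) xs)) ≡
  sum (map (w ∘ h) (filter P? xs))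
∑-filter P? h w N [] = ∑-zero N (λ m → ℕ.*-zeroʳ (w m))
∑-filter {P = P} P? h w N {x ∷ xs} (hx≤N ∷ hxs≤N) = go (P? x)
  where
  open ≡.≡-Reasoning

  with-hooks : ∀ m → Decidable (λ x → P x × h x ≡ m)
  with-hooks m x = P? x ×-dec (h x ℕ.≟ m)

  count : ℕ → List _ → ℕ
  count m xs = length (filter (with-hooks m) xs)

  count-∷ : P x → ∀ m → count m (x ∷ xs) ≡ δ (h x) m ℕ.+ count m xs
  count-∷ Px m with h x ℕ.≟ m
  ... | yes hx≡m = ≡.trans (≡.cong length (List.filter-accept (with-hooks m) (Px , hx≡m)))
                           (≡.cong (ℕ._+ count m xs) (≡.sym (δ-≡ hx≡m)))
  ... | no  hx≢m = ≡.trans (≡.cong length (List.filter-reject (with-hooks m) (hx≢m ∘ proj₂)))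
                           (≡.cong (ℕ._+ count m xs) (≡.sym (δ-≢ hx≢m)))

  go : Dec (P x) → ∑[m≤ N ] (λ m → w m * count m (x ∷ xs)) ≡ sum (map (w ∘ h) (filter P? (x ∷ xs)))
  go (no ¬Px) = begin
    ∑[m≤ N ] (λ m → w m * count m (x ∷ xs))
      ≡⟨ ∑-cong N (λ m → ≡.cong (λ ys → w m * length ys) (List.filter-reject (with-hooks m) (¬Px ∘ proj₁))) ⟩
    ∑[m≤ N ] (λ m → w m * count m xs)
      ≡⟨ ∑-filter P? h w N hxs≤N ⟩
    sum (map (w ∘ h) (filter P? xs))
      ≡⟨ ≡.cong (sum ∘ map (w ∘ h)) (List.filter-reject P? ¬Px) ⟨
    sum (map (w ∘ h) (filter P? (x ∷ xs))) ∎
  go (yes Px) = begin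
    ∑[m≤ N ] (λ m → w m * count m (x ∷ xs))
      ≡⟨ ∑-cong N (λ m → ≡.trans (≡.cong (w m *_) (count-∷ Px m)) (ℕ.*-distribˡ-+ (w m) (δ (h x) m) (count m xs))) ⟩
    ∑[m≤ N ] (λ m → w m * δ (h x) m ℕ.+ w m * count m xs)
      ≡⟨ ∑-+ N (λ m → w m * δ (h x) m) (λ m → w m * count m xs) ⟩
    ∑[m≤ N ] (λ m → w m * δ (h x) m) ℕ.+ ∑[m≤ N ] (λ m → w m * count m xs)
      ≡⟨ ≡.cong₂ ℕ._+_ (∑-δ w N hx≤N) (∑-filter P? h w N hxs≤N) ⟩
    sum (map (w ∘ h) (x ∷ filter P? xs))
      ≡⟨ ≡.cong (sum ∘ map (w ∘ h)) (List.filter-accept P? Px) ⟨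
    sum (map (w ∘ h) (filter P? (x ∷ xs))) ∎

-- Comparison with the enumeration of all partitions

partitions-hooks₂≤n : ∀ n → All (λ ps → hooks₂ ps ≤ n) (partitions n)
partitions-hooks₂≤n n = All.tabulate hooks₂≤n

-- A weakly decreasing list without repetitions decreases strictly. M will be L rounded up to an
-- even number.
distinct⊆ : ∀ {L M n ps} → L ≤ M → ps ∈ filter (distinctPartsAtMost? L) (partitions n) →
            ps ∈ filter (λ ps → sum ps ℕ.≟ n) (distinctLists M)
distinct⊆ {L} {M} {n} L≤M ps∈ with ∈-filter⁻ (distinctPartsAtMost? L) {xs = partitions n} ps∈
... | ps∈′ , ps! , ps≤L = ∈-filter⁺ (λ ps → sum ps ℕ.≟ n)
  (distinctLists-complete M
    (AllPairs.zipWith (λ (p≥r , p≢r) → ℕ.≤∧≢⇒< p≥r (p≢r ∘ ≡.sym))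
      (Linked⇒AllPairs (λ i≥j j≥k → ℕ.≤-trans j≥k i≥j) weaklyDecreasing , ps!))
    positive
    (All.map (λ p≤L → ℕ.≤-trans p≤L L≤M) ps≤L))
  total
  where open IsPartitionOf (partitions-sound {n} ps∈′)

odd⊆ : ∀ {N} {k} {n ps} → ps ∈ filter (λ ps → sum ps ℕ.≟ n) (oddLists N k) →
       ps ∈ filter (oddPartsAtMost? (2 * k ℕ.∸ 1)) (partitions n)
odd⊆ {N} {k} {n} ps∈ with ∈-filter⁻ (λ ps → sum ps ℕ.≟ n) {xs = oddLists N k} ps∈
... | ps∈′ , total with oddLists-sound N k ps∈′
...   | sorted , odd = ∈-filter⁺ (oddPartsAtMost? (2 * k ℕ.∸ 1))
  (partitions-complete record
    { weaklyDecreasing = AllPairs⇒Linked sorted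
    ; positive         = All.map (λ { {suc _} _ → s≤s z≤n }) odd
    ; total            = total
    })
  (All.map (λ {p} (p%2≡1 , p<2k) →
    p%2≡1 , ℕ.<⇒≤pred (≡.subst (p <_) (ℕ.*-comm k 2) p<2k)) odd)

open PowerSeries using (sum-hookPairs-≤)

mainTheorem3 : (L n : ℕ) → L ≥ 1 →
    ∑[m≤ n ] (λ m → (m C 2) * a₂ ⌈ L /2⌉ m n) ≥ ∑[m≤ n ] (λ m → (m C 2) * b₂ L m n)
-- For L = `suc l`, `⌈ L /2⌉` computes to `suc ⌊ l /2⌋`, the form in which the inequality between
-- the series is available.
mainTheorem3 L@(suc l) n _ = let N , distinct≤odd = sum-hookPairs-≤ ⌊ l /2⌋ n in begin
  ∑[m≤ n ] (λ m → (m C 2) * b₂ L m n)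
    ≡⟨ ∑-filter (distinctPartsAtMost? L) hooks₂ (_C 2) n (partitions-hooks₂≤n n) ⟩
  sum (map hookPairs (filter (distinctPartsAtMost? L) (partitions n)))
    ≤⟨ sum-map-mono-⊆ hookPairs (Unique.filter⁺ (distinctPartsAtMost? L) (partitions-unique n))
         (distinct⊆ (n≤⌈n/2⌉*2 L)) ⟩
  sum (map hookPairs (filter (λ ps → sum ps ℕ.≟ n) (distinctLists (⌈ L /2⌉ * 2))))
    ≤⟨ distinct≤odd ⟩
  sum (map hookPairs (filter (λ ps → sum ps ℕ.≟ n) (oddLists N ⌈ L /2⌉)))
    ≤⟨ sum-map-mono-⊆ hookPairs (Unique.filter⁺ (λ ps → sum ps ℕ.≟ n) (oddLists-unique N ⌈ L /2⌉))
         (odd⊆ {N} {⌈ L /2⌉}) ⟩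
  sum (map hookPairs (filter (oddPartsAtMost? (2 * ⌈ L /2⌉ ℕ.∸ 1)) (partitions n)))
    ≡⟨ ∑-filter (oddPartsAtMost? (2 * ⌈ L /2⌉ ℕ.∸ 1)) hooks₂ (_C 2) n (partitions-hooks₂≤n n) ⟨
  ∑[m≤ n ] (λ m → (m C 2) * a₂ ⌈ L /2⌉ m n) ∎
  where
  open ℕ.≤-Reasoning
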